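{- Let $\alpha_1$ be a nonzero algebraic number and let $\alpha_2,\dots,\alpha_k$ be all the other Galois conjugates of $\alpha_1$, where $k\ge2$. Let $K$ be the Galois closure of $\mathbb{Q}(\alpha_1)$ and $d=[K:\mathbb{Q}]$ (so $d\ge k$). Let $b_1,\dots,b_k$ be integers (not necessarily distinct) with $b_1+\cdots+b_k=n\neq0$. If $$\mathrm{Tr}_{K/\mathbb{Q}}(b_1\alpha_1^j+\cdots+b_k\alpha_k^j)\in\mathbb{Z}\quad\text{for all } j=1,2,\dots,d+d\lfloor\log_2(|n|d)\rfloor+1,$$ then $\alpha_1$ is an algebraic integer, and hence so is each $\alpha_j$, $j\ge2$.
   Context: $\mathrm{Tr}_{K/\mathbb{Q}}$ is the field trace and $\lfloor\cdot\rfloor$ the integer part. -}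

module Defs where

open import Algebra.Apartness.Bundles using (HeytingField; HeytingCommutativeRing)
open import Algebra.Bundles using (CommutativeRing)
open import Algebra.Morphism.Structures using (module RingMorphisms)
import Algebra.Properties.Semiring.Exp as Exp
import Algebra.Properties.Semiring.Sum as Sum
open import Data.Fin.Base using (Fin)
open import Data.Integer.Base using (ℤ)
import Data.Integer.Properties as ℤ
open import Data.List.Base using (List; []; _∷_; foldr; map)
open import Data.List.Relation.Unary.All using (All)
import Data.List.Relation.Unary.Unique.Setoid as Unique
open import Data.Nat.Base as ℕ using (ℕ; zero; suc)
open import Data.Product.Base using (Σ; ∃-syntax; _×_; proj₁)
open import Data.Rational.Base as ℚ using (ℚ; 0ℚ)
import Data.Rational.Properties as ℚ
open import Level using (_⊔_) renaming (suc to lsuc)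
open import Relation.Binary.PropositionalEquality.Core using (_≡_)
open import Relation.Nullary.Negation using (¬_)
open import Relation.Unary using (Pred; U)

fromℤ : ℤ → ℚ
fromℤ z = z ℚ./ 1

IsInteger : ℚ → Set
IsInteger q = ∃[ z ] q ≡ fromℤ z

module ℤ-Sum = Sum (CommutativeRing.semiring ℤ.+-*-commutativeRing)
module ℚ-Sum = Sum (CommutativeRing.semiring ℚ.+-*-commutativeRing)

-- A polynomial is its list of coefficients, constant term first; trailing
-- zeros are allowed, so polynomials are compared by _≋_ and never by _≡_.
module Polynomial {a ℓ} (R : CommutativeRing a ℓ) where
  open CommutativeRing R

  Poly : Set a
  Poly = List Carrier

  coeff : Poly → ℕ → Carrier
  coeff []      _       = 0#
  coeff (a ∷ p) zero    = a
  coeff (a ∷ p) (suc n) = coeff p n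

  infix 4 _≋_
  _≋_ : Poly → Poly → Set ℓ
  p ≋ q = ∀ n → coeff p n ≈ coeff q n

  infixl 6 _+ₚ_
  _+ₚ_ : Poly → Poly → Poly
  []      +ₚ q       = q
  (a ∷ p) +ₚ []      = a ∷ p
  (a ∷ p) +ₚ (b ∷ q) = (a + b) ∷ (p +ₚ q)

  infixl 7 _*ₚ_
  _*ₚ_ : Poly → Poly → Poly
  []      *ₚ q = []
  (a ∷ p) *ₚ q = map (a *_) q +ₚ (0# ∷ (p *ₚ q))

  eval : Poly → Carrier → Carrier
  eval p x = foldr (λ a r → a + x * r) 0# p

  Nonzero : Poly → Set ℓ
  Nonzero p = ∃[ n ] ¬ (coeff p n ≈ 0#)

  MonicOfDegree : ℕ → Poly → Set ℓ
  MonicOfDegree n p = coeff p n ≈ 1# × (∀ m → n ℕ.< m → coeff p m ≈ 0#)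

  -- ∏ (X − r) over r in the list
  ∏[X-_] : List Carrier → Poly
  ∏[X-_] = foldr (λ r p → (- r ∷ 1# ∷ []) *ₚ p) (1# ∷ [])

module ℤ[X] = Polynomial ℤ.+-*-commutativeRing
module ℚ[X] = Polynomial ℚ.+-*-commutativeRing

-- In a HeytingField, x # y means that x - y is invertible, and # is tight.
record FieldExtensionOfℚ c ℓ₁ ℓ₂ : Set (lsuc (c ⊔ ℓ₁ ⊔ ℓ₂)) where
  field
    heytingField : HeytingField c ℓ₁ ℓ₂

  commutativeRing : CommutativeRing c ℓ₁
  commutativeRing = HeytingCommutativeRing.commutativeRing
    (HeytingField.heytingCommutativeRing heytingField)

  open CommutativeRing commutativeRing public

  field
    ι : ℚ → Carrier
    ι-isRingHomomorphism : RingMorphisms.IsRingHomomorphism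
      (CommutativeRing.rawRing ℚ.+-*-commutativeRing) rawRing ι

module Extension {c ℓ₁ ℓ₂} (K : FieldExtensionOfℚ c ℓ₁ ℓ₂) where
  open FieldExtensionOfℚ K hiding (Carrier; _≈_; 0#; ι)
  open FieldExtensionOfℚ K public using (Carrier; _≈_; 0#; ι) renaming (_*_ to _·_)
  open Exp semiring public using (_^_)
  open Sum semiring public using (sum-syntax)
  open Unique setoid using (Unique)

  module K[X] = Polynomial commutativeRing

  ιₚ : ℚ[X].Poly → K[X].Poly
  ιₚ = map ι

  IsRoot : ℚ[X].Poly → Carrier → Set ℓ₁
  IsRoot p x = K[X].eval (ιₚ p) x ≈ 0#

  IsAlgebraic : Carrier → Set ℓ₁
  IsAlgebraic x = ∃[ p ] ℚ[X].Nonzero p × IsRoot p x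

  IsAlgebraicInteger : Carrier → Set ℓ₁
  IsAlgebraicInteger x =
    ∃[ p ] (∃[ n ] ℤ[X].MonicOfDegree n p) × IsRoot (map fromℤ p) x

  record IsMinimalPolynomial (p : ℚ[X].Poly) (x : Carrier) : Set ℓ₁ where
    field
      degree  : ℕ
      monic   : ℚ[X].MonicOfDegree degree p
      isRoot  : IsRoot p x
      minimal : ∀ q n → ℚ[X].MonicOfDegree n q → IsRoot q x → degree ℕ.≤ n

  IsConjugate : Carrier → Carrier → Set ℓ₁
  IsConjugate x y = ∃[ p ] IsMinimalPolynomial p x × IsRoot p y

  record EnumeratesConjugates (x : Carrier) {k} (α : Fin k → Carrier)
      : Set (c ⊔ ℓ₁) where
    field
      distinct  : ∀ i j → α i ≈ α j → i ≡ j
      conjugate : ∀ i → IsConjugate x (α i)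
      complete  : ∀ y → IsConjugate x y → ∃[ i ] y ≈ α i

  record IsSubfield {p} (F : Pred Carrier p) : Set (c ⊔ ℓ₁ ⊔ p) where
    field
      resp-≈     : ∀ {x y} → x ≈ y → F x → F y
      0-closed   : F 0#
      1-closed   : F 1#
      +-closed   : ∀ {x y} → F x → F y → F (x + y)
      neg-closed : ∀ {x} → F x → F (- x)
      *-closed   : ∀ {x y} → F x → F y → F (x * y)
      inv-closed : ∀ {x y} → F x → x * y ≈ 1# → F y

  -- F/ℚ is algebraic, normal and separable: every element of F has a minimal
  -- polynomial over ℚ, and it splits over F into distinct linear factors.
  IsGaloisOverℚ : ∀ {p} → Pred Carrier p → Set (c ⊔ ℓ₁ ⊔ p)
  IsGaloisOverℚ F = ∀ x → F x →
    ∃[ p ] IsMinimalPolynomial p x ×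
    (∃[ rs ] All F rs × Unique rs × ιₚ p K[X].≋ K[X].∏[X- rs ])

  -- K is the Galois closure of ℚ(x): K/ℚ is Galois, and no proper subfield
  -- of K containing x is Galois over ℚ.
  record IsGaloisClosureOfℚ⟨_⟩ (x : Carrier) : Set (lsuc (c ⊔ ℓ₁)) where
    field
      galois   : IsGaloisOverℚ (U {A = Carrier})
      smallest : (F : Pred Carrier (c ⊔ ℓ₁)) → IsSubfield F → F x →
                 IsGaloisOverℚ F → ∀ y → F y

  -- A ℚ-basis of K with d elements, witnessing [K : ℚ] = d.
  record Basis (d : ℕ) : Set (c ⊔ ℓ₁) where
    field
      e           : Fin d → Carrier
      spanning    : ∀ x → Σ (Fin d → ℚ) λ q → x ≈ ∑[ i < d ] (ι (q i) * e i)
      independent : ∀ (q : Fin d → ℚ) → ∑[ i < d ] (ι (q i) * e i) ≈ 0# →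
                    ∀ i → q i ≡ 0ℚ

    coord : Carrier → Fin d → ℚ
    coord x = proj₁ (spanning x)

  -- Tr_{K/ℚ}(x): the trace of the matrix of y ↦ x * y in the given basis.
  Tr : ∀ {d} → Basis d → Carrier → ℚ
  Tr B x = ℚ-Sum.sum λ i → coord (x * e i) i
    where open Basis B

-- Let m be the minimal polynomial of α₁, of degree k, let G = Xᵏ m(1/X), and let d = e k. For a
-- root β of m, K is free of rank e over ℚ(β), and expanding the trace in a basis βᵃ ω_b gives
-- Newton's identities for the numbers Tr(βʲ). They are linear in the traces and the same for all
-- conjugates, so S j = Tr(∑ bᵢ αᵢʲ) satisfies G S = n e (k G - X G′) as a power series.
--
-- Clear denominators in G. If a prime p divides G(0) but not all of G, let X^t be the first term
-- of G not divisible by p. Modulo p^N, where N = 1 + ⌊log₂ (|n| d)⌋, Weierstrass preparation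
-- writes G as P u with u a unit and P a monic polynomial of degree t, congruent to X^t modulo p.
-- Adding n e X u′/u - n e (k - t) to S gives a series w, integral up to degree L ≥ N t, such that
-- w(0) = n e t and P w = n e (t P - X P′) has degree < t. The latter expresses each coefficient
-- of w by p times later ones, at most t steps away, whence p^N divides w(0) = n e t. This is
-- impossible since 0 < |n e t| ≤ |n| d < 2^N. Hence G(0) divides G, that is, m is integral.
module Submission where

open import Defs
open import Algebra.Apartness.Bundles using (HeytingField)
open import Algebra.Bundles using (CommutativeRing)
open import Algebra.Morphism.Structures using (module RingMorphisms)
import Algebra.Properties.Ring as RingProperties
import Algebra.Properties.Semiring.Exp as Exp
import Algebra.Properties.Semiring.Sum as Sum
import Algebra.Solver.Ring.NaturalCoefficients.Default as SemiringSolver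
open import Data.Fin.Base using (Fin; zero; suc; toℕ)
open import Data.Fin.Properties using (toℕ<n)
open import Data.Integer.Base as ℤ using (ℤ; +_; -[1+_]; 0ℤ; 1ℤ; ∣_∣)
open import Data.Integer.Divisibility.Signed using (_∣_; divides; _∣?_; ∣ᵤ⇒∣; ∣⇒∣ᵤ)
import Data.Integer.Properties as ℤ
open import Data.Integer.Tactic.RingSolver using (solve-∀)
open import Data.List.Base using (List; []; _∷_; map)
open import Data.List.Relation.Unary.All using ([]; _∷_)
open import Data.Nat.Base as ℕ using (ℕ; zero; suc; z≤n; s≤s)
import Data.Nat.Coprimality as ℕ
import Data.Nat.DivMod as ℕ
import Data.Nat.Divisibility as ℕ
import Data.Nat.GCD as GCD
open import Data.Nat.Induction using (<-rec)
import Data.Nat.ListAction as ℕ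
open import Data.Nat.Logarithm using (⌊log₂_⌋; ⌊log₂⌋-mono-≤; ⌊log₂[2^n]⌋≡n)
open import Data.Nat.Primality using (Prime; prime⇒irreducible; prime⇒nonZero; prime⇒nonTrivial)
open import Data.Nat.Primality.Factorisation using (factorise)
import Data.Nat.Properties as ℕ
open import Data.Product.Base using (Σ; ∃-syntax; _×_; _,_; proj₁; proj₂)
open import Data.Rational.Base as ℚ using (ℚ; 0ℚ; 1ℚ)
import Data.Rational.Properties as ℚ
open import Data.Rational.Unnormalised.Base as ℚᵘ using (mkℚᵘ; *≡*)
import Data.Rational.Unnormalised.Properties as ℚᵘ
open import Data.Sum.Base using (_⊎_; inj₁; inj₂)
open import Data.Unit.Base using (⊤)
open import Data.Vec.Functional as Vector using (Vector)
open import Function.Base using (_∘_)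
open import Level using (_⊔_; 0ℓ)
open import Relation.Binary.PropositionalEquality as ≡ using (_≡_; _≢_)
import Relation.Binary.Reasoning.Setoid as SetoidReasoning
open import Relation.Nullary.Decidable using (Dec; yes; no; decidable-stable)
open import Relation.Nullary.Negation using (¬_; contradiction)
open import Relation.Unary using (U)

-- In p-adic terms t counts the conjugates that are not p-integral, P has their inverses as roots,
-- and w lists n e times their power sums: passing from G to P removes the p-integral conjugates.
-- Power sums of the others tend to acquire denominators, and integrality over N t degrees limits
-- how many such conjugates there can be. Working in ℤ/p^N keeps this finite: the iteration towards
-- P is exact after N steps, and all series are cut at degree L, up to which the traces are known to
-- be integral.
--
-- The trace is that of a matrix, so there are no sums over embeddings to start from. Newton's
-- identities come instead from Euler's dual basis: the coefficients of m(X)/(X - β) are dual to the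
-- powers of β for the functional that reads off the top coordinate. Equality in K is not decidable,
-- so the basis ω_b is available only up to double negation; what is drawn from it are equalities in
-- ℕ and ℚ.

-- Power series as coefficient sequences.

module Sequences {a ℓ} (R : CommutativeRing a ℓ) where
  open CommutativeRing R hiding (zero)
  open SemiringSolver commutativeSemiring using (solve; con; _:=_; _:+_; _:*_)
  open SetoidReasoning setoid

  Seq : Set a
  Seq = ℕ → Carrier

  trunc : ℕ → Seq → Seq
  trunc zero    f _       = 0#
  trunc (suc n) f zero    = f zero
  trunc (suc n) f (suc j) = trunc n (f ∘ suc) j

  -- The Cauchy product of power series. The recursion peels off the constant term of the left
  -- factor; `conv-snoc` is the mirror image that `conv-comm` rests on.
  conv : Seq → Seq → Seq
  conv f g zero    = f 0 * g 0
  conv f g (suc j) = f 0 * g (suc j) + conv (f ∘ suc) g j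

  trunc-< : ∀ n f {j} → j ℕ.< n → trunc n f j ≡ f j
  trunc-< (suc n) f {zero}  _         = ≡.refl
  trunc-< (suc n) f {suc j} (s≤s j<n) = trunc-< n (f ∘ suc) j<n

  trunc-≥ : ∀ n f {j} → n ℕ.≤ j → trunc n f j ≡ 0#
  trunc-≥ zero    f         _         = ≡.refl
  trunc-≥ (suc n) f {suc j} (s≤s n≤j) = trunc-≥ n (f ∘ suc) n≤j

  conv-cong : ∀ {f f′ g g′} j → (∀ i → i ℕ.≤ j → f i ≈ f′ i) →
              (∀ i → i ℕ.≤ j → g i ≈ g′ i) → conv f g j ≈ conv f′ g′ j
  conv-cong zero    p q = *-cong (p 0 z≤n) (q 0 z≤n)
  conv-cong (suc j) p q = +-cong (*-cong (p 0 z≤n) (q (suc j) ℕ.≤-refl))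
    (conv-cong j (λ i i≤j → p (suc i) (s≤s i≤j)) (λ i i≤j → q i (ℕ.m≤n⇒m≤1+n i≤j)))

  conv-distribʳ : ∀ f g h j → conv (λ i → f i + g i) h j ≈ conv f h j + conv g h j
  conv-distribʳ f g h zero    = distribʳ _ _ _
  conv-distribʳ f g h (suc j) = trans (+-congˡ (conv-distribʳ (f ∘ suc) (g ∘ suc) h j))
    (solve 5 (λ x y z u v → (x :+ y) :* z :+ (u :+ v) := (x :* z :+ u) :+ (y :* z :+ v))
      refl (f 0) (g 0) (h (suc j)) _ _)

  conv-scaleˡ : ∀ c f g j → conv (λ i → c * f i) g j ≈ c * conv f g j
  conv-scaleˡ c f g zero    = *-assoc _ _ _
  conv-scaleˡ c f g (suc j) = trans (+-congˡ (conv-scaleˡ c (f ∘ suc) g j))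
    (solve 4 (λ c x y u → c :* x :* y :+ c :* u := c :* (x :* y :+ u)) refl c (f 0) (g (suc j)) _)

  conv-snoc : ∀ f g j → conv f g (suc j) ≈ f (suc j) * g 0 + conv f (g ∘ suc) j
  conv-snoc f g zero    = +-comm _ _
  conv-snoc f g (suc j) = trans (+-congˡ (conv-snoc (f ∘ suc) g j))
    (solve 3 (λ x y z → x :+ (y :+ z) := y :+ (x :+ z)) refl _ _ _)

  conv-comm : ∀ f g j → conv f g j ≈ conv g f j
  conv-comm f g zero    = *-comm _ _
  conv-comm f g (suc j) = trans (+-cong (*-comm _ _) (conv-comm (f ∘ suc) g j))
    (sym (conv-snoc g f j))

  conv-assoc : ∀ f g h j → conv (conv f g) h j ≈ conv f (conv g h) j
  conv-assoc f g h zero    = *-assoc _ _ _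
  conv-assoc f g h (suc j) = begin
    f 0 * g 0 * h (suc j) + conv (λ i → f 0 * g (suc i) + conv (f ∘ suc) g i) h j
      ≈⟨ +-congˡ (conv-distribʳ _ _ h j) ⟩
    f 0 * g 0 * h (suc j) + (conv (λ i → f 0 * g (suc i)) h j + conv (conv (f ∘ suc) g) h j)
      ≈⟨ +-congˡ (+-cong (conv-scaleˡ (f 0) (g ∘ suc) h j) (conv-assoc (f ∘ suc) g h j)) ⟩
    f 0 * g 0 * h (suc j) + (f 0 * conv (g ∘ suc) h j + conv (f ∘ suc) (conv g h) j)
      ≈⟨ solve 5 (λ x y z u v → x :* y :* z :+ (x :* u :+ v) := x :* (y :* z :+ u) :+ v)
           refl _ _ _ _ _ ⟩
    f 0 * (g 0 * h (suc j) + conv (g ∘ suc) h j) + conv (f ∘ suc) (conv g h) j ∎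

  conv-zeroˡ : ∀ f g j → (∀ i → i ℕ.≤ j → f i ≈ 0#) → conv f g j ≈ 0#
  conv-zeroˡ f g zero    p = trans (*-congʳ (p 0 z≤n)) (zeroˡ _)
  conv-zeroˡ f g (suc j) p = trans
    (+-cong (trans (*-congʳ (p 0 z≤n)) (zeroˡ _))
            (conv-zeroˡ (f ∘ suc) g j (λ i i≤j → p (suc i) (s≤s i≤j))))
    (+-identityˡ _)

  -- The monomial X^t, so that `conv (δ t)` is a shift by t and `δ 0` is the unit series.
  δ : ℕ → Seq
  δ zero    zero    = 1#
  δ zero    (suc j) = 0#
  δ (suc t) zero    = 0#
  δ (suc t) (suc j) = δ t j

  conv-δ0 : ∀ f j → conv (δ 0) f j ≈ f j
  conv-δ0 f zero    = *-identityˡ _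
  conv-δ0 f (suc j) = trans (+-cong (*-identityˡ _) (conv-zeroˡ _ f j (λ _ _ → refl)))
    (+-identityʳ _)

  conv-δ : ∀ t f j → conv (δ t) f (t ℕ.+ j) ≈ f j
  conv-δ zero    f j = conv-δ0 f j
  conv-δ (suc t) f j = trans (+-cong (zeroˡ _) (conv-δ t f j)) (+-identityˡ _)

  trunc+drop : ∀ t f j → trunc t f j + conv (δ t) (λ i → f (t ℕ.+ i)) j ≈ f j
  trunc+drop zero    f j       = trans (+-identityˡ _) (conv-δ0 f j)
  trunc+drop (suc t) f zero    = trans (+-congˡ (zeroˡ _)) (+-identityʳ _)
  trunc+drop (suc t) f (suc j) =
    trans (+-congˡ (trans (+-congʳ (zeroˡ _)) (+-identityˡ _))) (trunc+drop t (f ∘ suc) j)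

  nat : ℕ → Carrier
  nat zero    = 0#
  nat (suc j) = 1# + nat j

  -- The Euler operator X d/dX. Unlike d/dX it preserves degrees, so it is compatible with cutting
  -- series off at L, and its values have no constant term.
  θ : Seq → Seq
  θ f j = nat j * f j

  θ-conv : ∀ f g j → θ (conv f g) j ≈ conv (θ f) g j + conv f (θ g) j
  θ-conv f g zero    =
    solve 2 (λ x y → con 0 :* (x :* y) := (con 0 :* x) :* y :+ x :* (con 0 :* y)) refl _ _
  θ-conv f g (suc j) = begin
    (1# + nat j) * (f 0 * g (suc j) + conv (f ∘ suc) g j)
      ≈⟨ solve 4 (λ n x y u → (con 1 :+ n) :* (x :* y :+ u)
           := u :+ x :* ((con 1 :+ n) :* y) :+ n :* u) refl _ _ _ _ ⟩
    conv (f ∘ suc) g j + f 0 * θ g (suc j) + nat j * conv (f ∘ suc) g j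
      ≈⟨ +-congˡ (θ-conv (f ∘ suc) g j) ⟩
    conv (f ∘ suc) g j + f 0 * θ g (suc j) + (conv (θ (f ∘ suc)) g j + conv (f ∘ suc) (θ g) j)
      ≈⟨ solve 6 (λ a b c d e z → a :+ b :+ (c :+ d) := con 0 :* e :* z :+ (a :+ c) :+ (b :+ d))
           refl _ _ _ _ (f 0) (g (suc j)) ⟩
    0# * f 0 * g (suc j) + (conv (f ∘ suc) g j + conv (θ (f ∘ suc)) g j)
      + (f 0 * θ g (suc j) + conv (f ∘ suc) (θ g) j)
      ≈⟨ +-congʳ (+-congˡ (conv-distribʳ (f ∘ suc) (θ (f ∘ suc)) g j)) ⟨
    0# * f 0 * g (suc j) + conv (λ i → f (suc i) + θ (f ∘ suc) i) g j
      + (f 0 * θ g (suc j) + conv (f ∘ suc) (θ g) j)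
      ≈⟨ +-congʳ (+-congˡ (conv-cong j (λ i _ →
           solve 2 (λ n x → x :+ n :* x := (con 1 :+ n) :* x) refl (nat i) (f (suc i)))
           (λ _ _ → refl))) ⟩
    0# * f 0 * g (suc j) + conv (θ f ∘ suc) g j
      + (f 0 * θ g (suc j) + conv (f ∘ suc) (θ g) j) ∎

  -- Long division by a series B with v * B 0 ≈ 1: the leading coefficient of
  -- the quotient is v * f 0, and the rest divides the tail of the remainder.
  divide : Carrier → Seq → Seq → Seq
  divide v B f zero    = v * f 0
  divide v B f (suc j) = divide v B (λ i → f (suc i) - v * f 0 * B (suc i)) j

  divide-correct : ∀ {v B} → v * B 0 ≈ 1# → ∀ f j → conv (divide v B f) B j ≈ f j
  divide-correct {v} {B} vB f zero    = begin
    v * f 0 * B 0   ≈⟨ solve 3 (λ v f b → v :* f :* b := v :* b :* f) refl _ _ _ ⟩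
    v * B 0 * f 0   ≈⟨ *-congʳ vB ⟩
    1# * f 0        ≈⟨ *-identityˡ _ ⟩
    f 0             ∎
  divide-correct {v} {B} vB f (suc j) = begin
    v * f 0 * B (suc j) + conv (divide v B _) B j  ≈⟨ +-congˡ (divide-correct vB _ j) ⟩
    v * f 0 * B (suc j) + (f (suc j) - v * f 0 * B (suc j))
      ≈⟨ solve 3 (λ x y z → x :+ (y :+ z) := y :+ (x :+ z)) refl _ _ _ ⟩
    f (suc j) + (v * f 0 * B (suc j) - v * f 0 * B (suc j))  ≈⟨ +-congˡ (-‿inverseʳ _) ⟩
    f (suc j) + 0#  ≈⟨ +-identityʳ _ ⟩
    f (suc j)       ∎

  -- R[[X]] / X^(L+1)
  module _ (L : ℕ) where
    truncatedSeries : CommutativeRing a ℓ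
    truncatedSeries = record
      { Carrier = Seq
      ; _≈_ = λ f g → ∀ j → j ℕ.≤ L → f j ≈ g j
      ; _+_ = λ f g j → f j + g j
      ; _*_ = conv
      ; -_  = λ f j → - f j
      ; 0#  = λ _ → 0#
      ; 1#  = δ 0
      ; isCommutativeRing = record
        { isRing = record
          { +-isAbelianGroup = record
            { isGroup = record
              { isMonoid = record
                { isSemigroup = record
                  { isMagma = record
                    { isEquivalence = record
                      { refl  = λ _ _ → refl
                      ; sym   = λ p j j≤L → sym (p j j≤L)
                      ; trans = λ p q j j≤L → trans (p j j≤L) (q j j≤L)
                      }
                    ; ∙-cong = λ p q j j≤L → +-cong (p j j≤L) (q j j≤L)
                    }
                  ; assoc = λ _ _ _ _ _ → +-assoc _ _ _
                  }
                ; identity = (λ _ _ _ → +-identityˡ _) , (λ _ _ _ → +-identityʳ _)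
                }
              ; inverse = (λ _ _ _ → -‿inverseˡ _) , (λ _ _ _ → -‿inverseʳ _)
              ; ⁻¹-cong = λ p j j≤L → -‿cong (p j j≤L)
              }
            ; comm = λ _ _ _ _ → +-comm _ _
            }
          ; *-cong = λ p q j j≤L → conv-cong j
              (λ i i≤j → p i (ℕ.≤-trans i≤j j≤L)) (λ i i≤j → q i (ℕ.≤-trans i≤j j≤L))
          ; *-assoc = λ f g h j _ → conv-assoc f g h j
          ; *-identity = (λ f j _ → conv-δ0 f j)
                       , (λ f j _ → trans (conv-comm f (δ 0) j) (conv-δ0 f j))
          ; distrib = (λ f g h j _ → trans (conv-comm f _ j) (trans (conv-distribʳ g h f j)
                        (+-cong (conv-comm g f j) (conv-comm h f j))))
                    , (λ f g h j _ → conv-distribʳ g h f j)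
          }
        ; *-comm = λ f g j _ → conv-comm f g j
        }
      }

-- Ring identities behind one step of Weierstrass preparation.

module WeierstrassStep {a ℓ} (A : CommutativeRing a ℓ) where
  open CommutativeRing A hiding (zero)
  open RingProperties ring
  open SemiringSolver commutativeSemiring using (solve; con; _:=_; _:+_; _:*_)
  open SetoidReasoning setoid

  -- This is v (1 + q C) = 1 solved for the first v: the inverse of an element congruent to 1 modulo
  -- q is itself congruent to 1 modulo q.
  inverse-of-1+ : ∀ {v B q C} → v * B ≈ 1# → B ≈ 1# + q * C → v ≈ 1# + q * - (C * v)
  inverse-of-1+ {v} {B} {q} {C} vB B≈ = begin
    v                                   ≈⟨ +-identityʳ _ ⟨
    v + 0#                              ≈⟨ +-congˡ (-‿inverseʳ _) ⟨
    v + (q * (C * v) - q * (C * v))     ≈⟨ solve 4 (λ v q c m → v :+ (q :* (c :* v) :+ m)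
                                             := v :* (con 1 :+ q :* c) :+ m) refl v q C _ ⟩
    v * (1# + q * C) - q * (C * v)      ≈⟨ +-cong (trans (*-congˡ (sym B≈)) vB)
                                                  (-‿distribʳ-* _ _) ⟩
    1# + q * - (C * v)                  ∎

  -- Multiplying by v makes the cofactor of X equal to 1 and, as v is 1 modulo q, disturbs Π A₁ only
  -- by a multiple of Π q. The part of that disturbance divisible by X moves next to the 1, where
  -- the modulus has improved from q to Π q. Here X stands for the monomial X^t.
  normalise : ∀ {G Π A₁ X B C v q lo hi} → G ≈ Π * A₁ + X * B → v * B ≈ 1# →
    B ≈ 1# + q * C → - (C * v) * A₁ ≈ lo + X * hi →
    v * G ≈ Π * (A₁ + q * lo) + X * (1# + (Π * q) * hi)
  normalise {G} {Π} {A₁} {X} {B} {C} {v} {q} {lo} {hi} G≈ vB B≈ split = begin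
    v * G                                  ≈⟨ *-congˡ G≈ ⟩
    v * (Π * A₁ + X * B)                   ≈⟨ solve 5 (λ v p a x b → v :* (p :* a :+ x :* b)
                                                := v :* (p :* a) :+ x :* (v :* b)) refl v Π A₁ X B ⟩
    v * (Π * A₁) + X * (v * B)             ≈⟨ +-cong (*-congʳ (inverse-of-1+ vB B≈)) (*-congˡ vB) ⟩
    (1# + q * c) * (Π * A₁) + X * 1#       ≈⟨ solve 5 (λ q c p a x →
                                                (con 1 :+ q :* c) :* (p :* a) :+ x :* con 1
                                                := p :* a :+ p :* q :* (c :* a) :+ x) refl q c Π A₁ X ⟩
    Π * A₁ + Π * q * (c * A₁) + X          ≈⟨ +-congʳ (+-congˡ (*-congˡ split)) ⟩
    Π * A₁ + Π * q * (lo + X * hi) + X     ≈⟨ solve 6 (λ p a q l x h →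
                                                p :* a :+ p :* q :* (l :+ x :* h) :+ x
                                                := p :* (a :+ q :* l) :+ x :* (con 1 :+ p :* q :* h))
                                                refl Π A₁ q lo X hi ⟩
    Π * (A₁ + q * lo) + X * (1# + (Π * q) * hi) ∎
    where c = - (C * v)

  -- As S is -n dG/G, the series for v G is S - n dv/v. Since 1/v = B and d(v B) = 0, the quotient
  -- dv/v equals -v dB, which gives the correction `n * (v * dB)`.
  log-derivative-of-product : ∀ {G S n v B dG dv dB} → G * S + n * dG ≈ 0# →
    dv * B + v * dB ≈ 0# → v * B ≈ 1# →
    (v * G) * (S + n * (v * dB)) + n * (dv * G + v * dG) ≈ 0#
  log-derivative-of-product {G} {S} {n} {v} {B} {dG} {dv} {dB} eq deq vB = begin
    (v * G) * (S + n * (v * dB)) + n * (dv * G + v * dG)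
      ≈⟨ solve 8 (λ G S n v b dG dv dB →
           (v :* G) :* (S :+ n :* (v :* dB)) :+ n :* (dv :* G :+ v :* dG)
           := v :* (G :* S :+ n :* dG) :+ n :* G :* (v :* (v :* dB) :+ dv :* con 1))
           refl G S n v B dG dv dB ⟩
    v * (G * S + n * dG) + n * G * (v * (v * dB) + dv * 1#)
      ≈⟨ +-cong (*-congˡ eq) (*-congˡ (+-congˡ (*-congˡ (sym vB)))) ⟩
    v * 0# + n * G * (v * (v * dB) + dv * (v * B))
      ≈⟨ solve 6 (λ n G v b dv dB → v :* con 0 :+ n :* G :* (v :* (v :* dB) :+ dv :* (v :* b))
           := n :* G :* v :* (dv :* b :+ v :* dB)) refl n G v B dv dB ⟩
    n * G * v * (dv * B + v * dB)  ≈⟨ *-congˡ deq ⟩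
    n * G * v * 0#                 ≈⟨ zeroʳ _ ⟩
    0#                             ∎

-- Weierstrass preparation and logarithmic derivatives modulo a nilpotent element.

+-*-shuffle : ∀ m t j → m ℕ.* t ℕ.+ (t ℕ.+ j) ≡ suc m ℕ.* t ℕ.+ j
+-*-shuffle m t j = ≡.trans (≡.sym (ℕ.+-assoc (m ℕ.* t) t j)) (≡.cong (ℕ._+ j) (ℕ.+-comm (m ℕ.* t) t))

module LogDerivative {a ℓ} (R : CommutativeRing a ℓ)
  (π n : CommutativeRing.Carrier R) (t L : ℕ) where
  open CommutativeRing R hiding (zero)
  open Sequences R
  open Exp semiring using (_^_)
  open RingProperties ring
  open SemiringSolver commutativeSemiring using (solve; con; _:=_; _:+_; _:*_)
  module 𝕊 = CommutativeRing (truncatedSeries L)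
  open WeierstrassStep (truncatedSeries L)

  const : Carrier → Seq
  const c j = c * δ 0 j

  const-conv : ∀ c f j → conv (const c) f j ≈ c * f j
  const-conv c f j = trans (conv-scaleˡ c (δ 0) f j) (*-congˡ (conv-δ0 f j))

  -- A pair G, S with G S = - n X G′, with G in Weierstrass form modulo πⁱ. Dividing G by B
  -- keeps the equation, with the same S(0), and improves i by one.
  record Stage (i : ℕ) (S₀ : Carrier) : Set (a ⊔ ℓ) where
    field
      G S A₁ B C v : Seq
      A₁-low       : ∀ j → t ℕ.≤ j → A₁ j ≈ 0#
      G-split      : G 𝕊.≈ const π 𝕊.* A₁ 𝕊.+ δ t 𝕊.* B
      B-split      : B 𝕊.≈ 𝕊.1# 𝕊.+ const (π ^ i) 𝕊.* C
      v-inverse    : v 𝕊.* B 𝕊.≈ 𝕊.1#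
      equation     : G 𝕊.* S 𝕊.+ const n 𝕊.* θ G 𝕊.≈ 𝕊.0#
      S-head       : S 0 ≈ S₀

  invertible : ∀ {B} → (∃[ v ] v * B 0 ≈ 1#) → ∃[ v ] v 𝕊.* B 𝕊.≈ 𝕊.1#
  invertible {B} (v , vB) = divide v B (δ 0) , λ j _ → divide-correct vB (δ 0) j

  -- In other words, π lies in the Jacobson radical. It makes the constant term of each new B
  -- invertible, and with it B itself.
  OnePlusπInvertible : Set (a ⊔ ℓ)
  OnePlusπInvertible = ∀ z → ∃[ v ] v * (1# + π * z) ≈ 1#

  next : OnePlusπInvertible → ∀ {i S₀} → Stage i S₀ → Stage (suc i) S₀
  next unit {i} {S₀} st = record
    { G         = v 𝕊.* G
    ; S         = S 𝕊.+ const n 𝕊.* (v 𝕊.* θ B)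
    ; A₁        = A₁ 𝕊.+ const (π ^ i) 𝕊.* lo
    ; B         = B′
    ; C         = hi
    ; v         = proj₁ B′-invertible
    ; A₁-low    = λ j t≤j → trans (+-cong (A₁-low j t≤j)
        (trans (const-conv _ lo j) (trans (*-congˡ (reflexive (trunc-≥ t E t≤j))) (zeroʳ _))))
        (+-identityˡ _)
    ; G-split   = 𝕊.trans (normalise {Π = const π} {A₁ = A₁} {q = const (π ^ i)} {lo = lo} {hi = hi}
        G-split v-inverse B-split (λ j _ → sym (trunc+drop t E j)))
        (𝕊.+-congˡ {x = const π 𝕊.* (A₁ 𝕊.+ const (π ^ i) 𝕊.* lo)}
          (𝕊.*-congˡ {x = δ t} (𝕊.+-congˡ {x = 𝕊.1#} (𝕊.*-congʳ {x = hi} Ππⁱ))))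
    ; B-split   = 𝕊.refl
    ; v-inverse = proj₂ B′-invertible
    ; equation  = 𝕊.trans (𝕊.+-congˡ {x = (v 𝕊.* G) 𝕊.* (S 𝕊.+ const n 𝕊.* (v 𝕊.* θ B))}
        (𝕊.*-congˡ {x = const n} (λ j _ → θ-conv v G j)))
        (log-derivative-of-product {G = G} {S} {const n} {v} {B} {θ G} {θ v} {θ B}
          equation θ1≈0 v-inverse)
    -- `θ B` has no constant term, so the correction leaves `S 0` unchanged.
    ; S-head    = trans (+-congˡ (trans (*-congˡ (trans (*-congˡ (zeroˡ _)) (zeroʳ _))) (zeroʳ _)))
        (trans (+-identityʳ _) S-head)
    }
    where
    open Stage st
    -- Since v = 1 + πⁱ (- C v), multiplication by v adds π πⁱ E to π A₁. The terms of E below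
    -- degree t are absorbed by A₁, the others by B.
    E  = 𝕊.- (C 𝕊.* v) 𝕊.* A₁
    lo = trunc t E
    hi = λ j → E (t ℕ.+ j)
    B′ = 𝕊.1# 𝕊.+ const (π ^ suc i) 𝕊.* hi

    Ππⁱ : const π 𝕊.* const (π ^ i) 𝕊.≈ const (π ^ suc i)
    Ππⁱ j _ = trans (const-conv π _ j) (sym (*-assoc _ _ _))

    B′-invertible : ∃[ w ] w 𝕊.* B′ 𝕊.≈ 𝕊.1#
    B′-invertible = invertible (proj₁ (unit (π ^ i * hi 0)) ,
      trans (*-congˡ (+-congˡ (solve 3 (λ p q h → p :* q :* con 1 :* h := p :* (q :* h)) refl _ _ _)))
            (proj₂ (unit (π ^ i * hi 0))))

    θ1≈0 : θ v 𝕊.* B 𝕊.+ v 𝕊.* θ B 𝕊.≈ 𝕊.0#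
    θ1≈0 j j≤L = trans (sym (θ-conv v B j)) (trans (*-congˡ (v-inverse j j≤L)) (θδ0 j))
      where
      θδ0 : ∀ j → θ (δ 0) j ≈ 0#
      θδ0 zero    = zeroˡ _
      θδ0 (suc j) = zeroʳ _

  stage : OnePlusπInvertible → ∀ {S₀} → Stage 0 S₀ → ∀ i → Stage i S₀
  stage unit st zero    = st
  stage unit st (suc i) = next unit (stage unit st i)

  Multiple : Carrier → Carrier → Set (a ⊔ ℓ)
  Multiple c x = ∃[ z ] x ≈ c * z

  conv-multiple : ∀ {c} f g j → (∀ i → i ℕ.≤ j → Multiple c (g i)) → Multiple c (conv f g j)
  conv-multiple {c} f g zero    h with z , eq ← h 0 z≤n =
    f 0 * z , trans (*-congˡ eq) (solve 3 (λ f c z → f :* (c :* z) := c :* (f :* z)) refl _ _ _)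
  conv-multiple {c} f g (suc j) h
    with z , eq ← h (suc j) ℕ.≤-refl
       | y , eq′ ← conv-multiple (f ∘ suc) g j (λ i i≤j → h i (ℕ.m≤n⇒m≤1+n i≤j)) =
    f 0 * z + y , trans (+-cong (*-congˡ eq) eq′)
      (solve 4 (λ f c z y → f :* (c :* z) :+ c :* y := c :* (f :* z :+ y)) refl _ _ _ _)

  module _ {N S₀} (nilpotent : π ^ N ≈ 0#) (st : Stage N S₀) where
    open Stage st
    open SetoidReasoning setoid

    w : Seq
    w = S 𝕊.+ const (n * nat t)

    -- At stage N the deviation of B from 1 carries the factor π^N = 0. So G has become the
    -- Weierstrass polynomial exactly, with no limit taken.
    G-monic : G 𝕊.≈ const π 𝕊.* A₁ 𝕊.+ δ t
    G-monic = 𝕊.trans G-split (𝕊.+-congˡ {x = const π 𝕊.* A₁}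
      (𝕊.trans (𝕊.*-congˡ {x = δ t} B≈1) (𝕊.*-identityʳ (δ t))))
      where
      B≈1 : B 𝕊.≈ 𝕊.1#
      B≈1 j j≤L = trans (B-split j j≤L) (trans (+-congˡ (trans (const-conv _ C j)
        (trans (*-congʳ nilpotent) (zeroˡ _)))) (+-identityʳ _))

    G-degree : ∀ j → t ℕ.< j → j ℕ.≤ L → G j ≈ 0#
    G-degree j t<j j≤L = trans (G-monic j j≤L) (trans (+-cong
      (trans (const-conv π A₁ j) (trans (*-congˡ (A₁-low j (ℕ.<⇒≤ t<j))) (zeroʳ _)))
      (δ-≢ t j t<j)) (+-identityˡ _))
      where
      δ-≢ : ∀ t j → t ℕ.< j → δ t j ≈ 0#
      δ-≢ zero    (suc j) _         = refl
      δ-≢ (suc t) (suc j) (s≤s t<j) = δ-≢ t j t<j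

    -- The coefficient is n (t - j) times that of G: the first factor vanishes at j = t, the second
    -- beyond t by `G-degree`.
    conv-Gw : ∀ j → t ℕ.≤ j → j ℕ.≤ L → conv G w j ≈ 0#
    conv-Gw j t≤j j≤L = begin
      conv G w j                            ≈⟨ 𝕊.distribˡ G S (const (n * nat t)) j j≤L ⟩
      conv G S j + conv G (const (n * nat t)) j
        ≈⟨ +-congˡ (trans (conv-comm G _ j) (const-conv _ G j)) ⟩
      conv G S j + n * nat t * G j          ≈⟨ +-congˡ (natG (ℕ.m≤n⇒m<n∨m≡n t≤j)) ⟩
      conv G S j + n * (nat j * G j)        ≈⟨ +-congˡ (const-conv n (θ G) j) ⟨
      conv G S j + conv (const n) (θ G) j   ≈⟨ equation j j≤L ⟩
      0#                                    ∎
      where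
      natG : _ → n * nat t * G j ≈ n * (nat j * G j)
      natG (inj₂ ≡.refl) = *-assoc _ _ _
      natG (inj₁ t<j)    = trans (trans (*-congˡ G≈0) (zeroʳ _))
        (sym (trans (*-congˡ (trans (*-congˡ G≈0) (zeroʳ _))) (zeroʳ _)))
        where G≈0 = G-degree j t<j j≤L

    -- Read downwards, G w = 0 (in degrees ≥ t) gains a factor π every t steps.
    w-recurrence : ∀ j → t ℕ.+ j ℕ.≤ L → w j ≈ π * - conv A₁ w (t ℕ.+ j)
    w-recurrence j j≤L = begin
      w j                                  ≈⟨ +-identityˡ _ ⟨
      0# + w j                             ≈⟨ +-congʳ (-‿inverseˡ _) ⟨
      (- (π * A₁w) + π * A₁w) + w j        ≈⟨ +-assoc _ _ _ ⟩
      - (π * A₁w) + (π * A₁w + w j)        ≈⟨ +-congˡ (trans (sym expand) (conv-Gw J (ℕ.m≤m+n t j) j≤L)) ⟩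
      - (π * A₁w) + 0#                     ≈⟨ +-identityʳ _ ⟩
      - (π * A₁w)                          ≈⟨ -‿distribʳ-* _ _ ⟩
      π * - A₁w                            ∎
      where
      J   = t ℕ.+ j
      A₁w = conv A₁ w J
      expand : conv G w J ≈ π * A₁w + w j
      expand = trans (𝕊.*-congʳ {x = w} G-monic J j≤L) (trans (conv-distribʳ _ (δ t) w J)
        (+-cong (trans (conv-assoc (const π) A₁ w J) (const-conv π _ J)) (conv-δ t w j)))

    -- `w-recurrence` at j involves w only up to degree t + j, so every factor π uses up t of the
    -- available degrees. The induction on m treats all j at once because `conv-multiple` needs each
    -- of those coefficients to be divisible.
    w-multiple : ∀ m j → m ℕ.* t ℕ.+ j ℕ.≤ L → Multiple (π ^ m) (w j)
    w-multiple zero    j _   = w j , sym (*-identityˡ _)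
    w-multiple (suc m) j j≤L
      with z , eq ← conv-multiple A₁ w (t ℕ.+ j) (λ i i≤ → w-multiple m i (ℕ.≤-trans
             (ℕ.≤-trans (ℕ.+-monoʳ-≤ (m ℕ.* t) i≤) (ℕ.≤-reflexive (+-*-shuffle m t j))) j≤L)) =
      - z , trans (w-recurrence j (ℕ.≤-trans (ℕ.+-monoˡ-≤ j (ℕ.m≤m+n t (m ℕ.* t))) j≤L)) (begin
        π * - conv A₁ w (t ℕ.+ j)   ≈⟨ *-congˡ (-‿cong eq) ⟩
        π * - (π ^ m * z)           ≈⟨ *-congˡ (-‿distribʳ-* _ _) ⟩
        π * (π ^ m * - z)           ≈⟨ *-assoc _ _ _ ⟨
        π ^ suc m * - z             ∎)

    w-head : N ℕ.* t ℕ.≤ L → S₀ + n * nat t ≈ 0#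
    w-head Nt≤L with z , eq ← w-multiple N 0 (ℕ.≤-trans (ℕ.≤-reflexive (ℕ.+-identityʳ _)) Nt≤L) =
      trans (+-cong (sym S-head) (sym (*-identityʳ _)))
        (trans eq (trans (*-congʳ nilpotent) (zeroˡ _)))

  -- G and its Weierstrass polynomial, which has degree t, differ by a unit, so the two series S
  -- differ by the logarithmic derivative of a unit, which has no constant term.
  log-derivative-head : OnePlusπInvertible → ∀ {N} → π ^ N ≈ 0# → N ℕ.* t ℕ.≤ L →
    ∀ (G S : Seq) → (∀ j → j ℕ.< t → Multiple π (G j)) → (∃[ v ] v * G t ≈ 1#) →
    (∀ j → j ℕ.≤ L → conv G S j + n * (nat j * G j) ≈ 0#) → S 0 + n * nat t ≈ 0#
  log-derivative-head unit {N} nilpotent Nt≤L G S low G-unit eqn =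
    w-head nilpotent (stage unit stage₀ N) Nt≤L
    where
    low′ : ∀ s (f : Seq) → (∀ j → j ℕ.< s → Multiple π (f j)) → ∀ j → Multiple π (trunc s f j)
    low′ s f h j with ℕ.<-≤-connex j s
    ... | inj₁ j<s = proj₁ (h j j<s) , trans (reflexive (trunc-< s f j<s)) (proj₂ (h j j<s))
    ... | inj₂ s≤j = 0# , trans (reflexive (trunc-≥ s f s≤j)) (sym (zeroʳ π))
    A₁ = trunc t (λ j → proj₁ (low′ t G low j))
    B  = λ j → G (t ℕ.+ j)
    πA₁ : ∀ j → π * A₁ j ≈ trunc t G j
    πA₁ j with ℕ.<-≤-connex j t
    ... | inj₁ j<t = trans (*-congˡ (reflexive (trunc-< t _ j<t))) (sym (proj₂ (low′ t G low j)))
    ... | inj₂ t≤j = trans (*-congˡ (reflexive (trunc-≥ t _ t≤j)))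
      (trans (zeroʳ π) (reflexive (≡.sym (trunc-≥ t G t≤j))))
    B-invertible : ∃[ v ] v 𝕊.* B 𝕊.≈ 𝕊.1#
    B-invertible = invertible (proj₁ G-unit ,
      trans (*-congˡ (reflexive (≡.cong G (ℕ.+-identityʳ t)))) (proj₂ G-unit))
    stage₀ : Stage 0 (S 0)
    stage₀ = record
      -- Modulo π⁰ = 1 nothing is asked of B, so C is simply B - 1.
      { G = G ; S = S ; A₁ = A₁ ; B = B ; C = B 𝕊.- 𝕊.1# ; v = proj₁ B-invertible
      ; A₁-low = λ j t≤j → reflexive (trunc-≥ t _ t≤j)
      ; G-split = λ j _ → sym (trans (+-congʳ (trans (const-conv π A₁ j) (πA₁ j))) (trunc+drop t G j))
      ; B-split = λ j _ → sym (trans (+-congˡ (trans (const-conv 1# _ j) (*-identityˡ _)))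
          (trans (+-comm _ _) (trans (+-assoc _ _ _) (trans (+-congˡ (-‿inverseˡ _)) (+-identityʳ _)))))
      ; v-inverse = proj₂ B-invertible
      ; equation = λ j j≤L → trans (+-congˡ (const-conv n (θ G) j)) (eqn j j≤L)
      ; S-head = refl
      }

-- Prime powers and divisibility of integer coefficients.

module ℤ-Seq = Sequences ℤ.+-*-commutativeRing
module ℚ-Seq = Sequences ℚ.+-*-commutativeRing

module _ where
  open import Data.Integer.Base using (_+_; _*_; -_; _-_)
  open ≡ using (refl; sym; trans; cong; cong₂; subst; module ≡-Reasoning)

  -- ℤ/M with carrier ℤ and congruence as equality: its operations are those of ℤ, so integer
  -- sequences and identities can be read in it as they stand.
  ℤ-mod : ℤ → CommutativeRing 0ℓ 0ℓ
  ℤ-mod M = record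
    { Carrier = ℤ
    ; _≈_ = λ x y → ∃[ q ] x ≡ y + q * M
    ; _+_ = _+_
    ; _*_ = _*_
    ; -_  = -_
    ; 0#  = 0ℤ
    ; 1#  = 1ℤ
    ; isCommutativeRing = record
      { isRing = record
        { +-isAbelianGroup = record
          { isGroup = record
            { isMonoid = record
              { isSemigroup = record
                { isMagma = record
                  { isEquivalence = record
                    { refl  = λ {x} → mod-refl x
                    ; sym   = λ {x} {y} → mod-sym x y
                    ; trans = λ {x} {y} {z} → mod-trans x y z
                    }
                  ; ∙-cong = λ {x} {y} {u} {v} → +-mod x y u v
                  }
                ; assoc = λ x y z → ≡⇒mod (ℤ.+-assoc x y z)
                }
              ; identity = (λ x → ≡⇒mod (ℤ.+-identityˡ x)) , (λ x → ≡⇒mod (ℤ.+-identityʳ x))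
              }
            ; inverse = (λ x → ≡⇒mod (ℤ.+-inverseˡ x)) , (λ x → ≡⇒mod (ℤ.+-inverseʳ x))
            ; ⁻¹-cong = λ {x} {y} → neg-mod x y
            }
          ; comm = λ x y → ≡⇒mod (ℤ.+-comm x y)
          }
        ; *-cong = λ {x} {y} {u} {v} → *-mod x y u v
        ; *-assoc = λ x y z → ≡⇒mod (ℤ.*-assoc x y z)
        ; *-identity = (λ x → ≡⇒mod (ℤ.*-identityˡ x)) , (λ x → ≡⇒mod (ℤ.*-identityʳ x))
        ; distrib = (λ x y z → ≡⇒mod (ℤ.*-distribˡ-+ x y z)) , (λ x y z → ≡⇒mod (ℤ.*-distribʳ-+ x y z))
        }
      ; *-comm = λ x y → ≡⇒mod (ℤ.*-comm x y)
      }
    }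
    where
    mod-refl : ∀ x → ∃[ q ] x ≡ x + q * M
    mod-refl x = 0ℤ , sym (ℤ.+-identityʳ x)

    ≡⇒mod : ∀ {x y} → x ≡ y → ∃[ q ] x ≡ y + q * M
    ≡⇒mod {x} refl = mod-refl x

    mod-sym : ∀ x y → ∃[ q ] x ≡ y + q * M → ∃[ q ] y ≡ x + q * M
    mod-sym x y (q , refl) = - q , identity y q M
      where identity : ∀ y q M → y ≡ y + q * M + - q * M
            identity = solve-∀

    mod-trans : ∀ x y z → ∃[ q ] x ≡ y + q * M → ∃[ q ] y ≡ z + q * M → ∃[ q ] x ≡ z + q * M
    mod-trans x y z (q , refl) (r , refl) = r + q , identity z q r M
      where identity : ∀ z q r M → z + r * M + q * M ≡ z + (r + q) * M
            identity = solve-∀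

    +-mod : ∀ x y u v → ∃[ q ] x ≡ y + q * M → ∃[ q ] u ≡ v + q * M → ∃[ q ] x + u ≡ (y + v) + q * M
    +-mod x y u v (q , refl) (r , refl) = q + r , identity y v q r M
      where identity : ∀ y v q r M → y + q * M + (v + r * M) ≡ y + v + (q + r) * M
            identity = solve-∀

    *-mod : ∀ x y u v → ∃[ q ] x ≡ y + q * M → ∃[ q ] u ≡ v + q * M → ∃[ q ] x * u ≡ y * v + q * M
    *-mod x y u v (q , refl) (r , refl) = y * r + q * v + q * r * M , identity y v q r M
      where identity : ∀ y v q r M → (y + q * M) * (v + r * M) ≡ y * v + (y * r + q * v + q * r * M) * M
            identity = solve-∀

    neg-mod : ∀ x y → ∃[ q ] x ≡ y + q * M → ∃[ q ] - x ≡ - y + q * M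
    neg-mod x y (q , refl) = - q , identity y q M
      where identity : ∀ y q M → - (y + q * M) ≡ - y + - q * M
            identity = solve-∀

  prime-divisor : ∀ n → 1 ℕ.< n → ∃[ p ] Prime p × p ℕ.∣ n
  prime-divisor n@(suc _) 1<n with factorise n
  ... | record { factors = [] ; isFactorisation = eq } = contradiction eq (ℕ.>⇒≢ 1<n)
  ... | record { factors = p ∷ ps ; isFactorisation = eq ; factorsPrime = pr ∷ _ } =
    p , pr , ℕ.divides (ℕ.product ps) (trans eq (ℕ.*-comm p (ℕ.product ps)))

  ∤⇒inverse-mod-p : ∀ {p z} → Prime p → ¬ (+ p ∣ z) → ∃[ v ] ∃[ q ] v * z ≡ 1ℤ + q * + p
  ∤⇒inverse-mod-p {p} {z} pr p∤z = combine (sign-factor z) bézout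
    where
    sign-factor : ∀ z → ∃[ s ] + ∣ z ∣ ≡ s * z
    sign-factor (+ n)      = 1ℤ , sym (ℤ.*-identityˡ (+ n))
    sign-factor -[1+ n ]   = - 1ℤ , sym (ℤ.-1*i≡-i -[1+ n ])
    coprime : ℕ.Coprime ∣ z ∣ p
    coprime (d∣z , d∣p) with prime⇒irreducible pr d∣p
    ... | inj₁ d≡1  = d≡1
    ... | inj₂ refl = contradiction (∣ᵤ⇒∣ d∣z) p∤z
    bézout : ∃[ v ] ∃[ q ] v * + ∣ z ∣ ≡ 1ℤ + q * + p
    bézout with ℕ.coprime-Bézout coprime
    ... | GCD.Bézout.Identity.+- x y eq = + x , + y , (begin
      + x * + ∣ z ∣         ≡⟨ ℤ.pos-* x ∣ z ∣ ⟨
      + (x ℕ.* ∣ z ∣)       ≡⟨ cong +_ eq ⟨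
      1ℤ + + (y ℕ.* p)      ≡⟨ cong (λ x → 1ℤ + x) (ℤ.pos-* y p) ⟩
      1ℤ + + y * + p        ∎)
      where open ≡-Reasoning
    ... | GCD.Bézout.Identity.-+ x y eq = - + x , - + y , (begin
      - + x * + ∣ z ∣                   ≡⟨ identity (+ x) (+ ∣ z ∣) ⟩
      1ℤ - (1ℤ + + x * + ∣ z ∣)         ≡⟨ cong (λ u → 1ℤ - (1ℤ + u)) (ℤ.pos-* x ∣ z ∣) ⟨
      1ℤ - + (1 ℕ.+ x ℕ.* ∣ z ∣)        ≡⟨ cong (λ u → 1ℤ - + u) eq ⟩
      1ℤ - + (y ℕ.* p)                  ≡⟨ cong (λ x → 1ℤ - x) (ℤ.pos-* y p) ⟩
      1ℤ - + y * + p                    ≡⟨ cong (λ x → 1ℤ + x) (ℤ.neg-distribˡ-* (+ y) (+ p)) ⟩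
      1ℤ + - + y * + p                  ∎)
      where
      open ≡-Reasoning
      identity : ∀ x z → - x * z ≡ 1ℤ - (1ℤ + x * z)
      identity = solve-∀
    combine : ∃[ s ] + ∣ z ∣ ≡ s * z → ∃[ v ] ∃[ q ] v * + ∣ z ∣ ≡ 1ℤ + q * + p →
      ∃[ v ] ∃[ q ] v * z ≡ 1ℤ + q * + p
    combine (s , +∣z∣≡s*z) (v , q , eq) = v * s , q , trans (ℤ.*-assoc v s z) (trans (cong (v *_) (sym +∣z∣≡s*z)) eq)

  -- If p divides 1 - v z and p^N divides 1 - u z, then p^(N+1) divides their product, which is 1
  -- minus z times `v + u - v * u * z`.
  ∤⇒inverse-mod-p^ : ∀ {p z} → Prime p → ¬ (+ p ∣ z) → ∀ N →
    ∃[ v ] ∃[ q ] v * z ≡ 1ℤ + q * + (p ℕ.^ N)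
  ∤⇒inverse-mod-p^ pr p∤z zero = 0ℤ , - 1ℤ , refl
  ∤⇒inverse-mod-p^ {p} {z} pr p∤z (suc N)
    with v , q , eq ← ∤⇒inverse-mod-p pr p∤z | u , r , eq′ ← ∤⇒inverse-mod-p^ pr p∤z N =
    v + u - v * u * z , - (q * r) , (begin
      (v + u - v * u * z) * z               ≡⟨ identity₁ v u z ⟩
      1ℤ - (1ℤ - v * z) * (1ℤ - u * z)      ≡⟨ cong₂ (λ x y → 1ℤ - (1ℤ - x) * (1ℤ - y)) eq eq′ ⟩
      1ℤ - (1ℤ - (1ℤ + q * + p)) * (1ℤ - (1ℤ + r * + (p ℕ.^ N)))
                                            ≡⟨ identity₂ q r (+ p) (+ (p ℕ.^ N)) ⟩
      1ℤ + - (q * r) * (+ p * + (p ℕ.^ N))  ≡⟨ cong (λ x → 1ℤ + - (q * r) * x) (ℤ.pos-* p (p ℕ.^ N)) ⟨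
      1ℤ + - (q * r) * + (p ℕ.^ suc N)      ∎)
    where
    open ≡-Reasoning
    identity₁ : ∀ v u z → (v + u - v * u * z) * z ≡ 1ℤ - (1ℤ - v * z) * (1ℤ - u * z)
    identity₁ = solve-∀
    identity₂ : ∀ q r x y → 1ℤ - (1ℤ - (1ℤ + q * x)) * (1ℤ - (1ℤ + r * y)) ≡ 1ℤ + - (q * r) * (x * y)
    identity₂ = solve-∀

  first-nondivisible : ∀ p (g : ℕ → ℤ) m → (∀ j → j ℕ.< m → p ∣ g j) ⊎
    ∃[ t ] t ℕ.< m × ¬ (p ∣ g t) × (∀ j → j ℕ.< t → p ∣ g j)
  first-nondivisible p g zero = inj₁ λ _ ()
  first-nondivisible p g (suc m) with first-nondivisible p g m
  ... | inj₂ (t , t<m , rest) = inj₂ (t , ℕ.m<n⇒m<1+n t<m , rest)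
  ... | inj₁ all with p ∣? g m
  ...   | no p∤gm  = inj₂ (m , ℕ.n<1+n m , p∤gm , all)
  ...   | yes p∣gm = inj₁ λ j j<1+m → case (ℕ.m<1+n⇒m<n∨m≡n j<1+m)
    where
    case : ∀ {j} → j ℕ.< m ⊎ j ≡ m → p ∣ g j
    case (inj₁ j<m)  = all _ j<m
    case (inj₂ refl) = p∣gm

  open ℤ-Seq using (conv; conv-cong; conv-distribʳ; conv-scaleˡ; conv-comm; conv-δ0; δ)

  module _ {p : ℕ} (pr : Prime p) (N : ℕ) where
    private
      M : ℤ
      M = + (p ℕ.^ N)
      module R = CommutativeRing (ℤ-mod M)
      module Mod = Sequences (ℤ-mod M)

      ≡⇒≈ : ∀ {x y} → x ≡ y → x R.≈ y
      ≡⇒≈ refl = R.refl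

      conv-mod : ∀ f g j → Mod.conv f g j ≡ conv f g j
      conv-mod f g zero    = refl
      conv-mod f g (suc j) = cong (λ x → f 0 * g (suc j) + x) (conv-mod (λ i → f (suc i)) g j)

      nat-mod : ∀ j → Mod.nat j ≡ + j
      nat-mod zero    = refl
      nat-mod (suc j) = cong (λ x → 1ℤ + x) (nat-mod j)

      open Exp R.semiring using (_^_)

      ^-mod : ∀ i → (+ p) ^ i ≡ + (p ℕ.^ i)
      ^-mod zero    = refl
      ^-mod (suc i) = trans (cong (+ p *_) (^-mod i)) (sym (ℤ.pos-* p (p ℕ.^ i)))

    -- `log-derivative-head` in ℤ/p^N with π = p. There p^N = 0, and both 1 + p z and `g t` are
    -- prime to p, hence invertible.
    log-derivative-ℤ : ∀ (n : ℤ) {t L} → N ℕ.* t ℕ.≤ L → (g s : ℕ → ℤ) →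
      (∀ j → j ℕ.< t → + p ∣ g j) → ¬ (+ p ∣ g t) →
      (∀ j → j ℕ.≤ L → conv g s j + n * (+ j * g j) ≡ 0ℤ) → M ∣ s 0 + n * + t
    log-derivative-ℤ n {t} {L} Nt≤L g s low p∤gt eqn = conclude
      (log-derivative-head unit {N} nilpotent Nt≤L g s low′ (∤⇒inverse-mod-p^ pr p∤gt N) eqn′)
      where
      conclude : s 0 + n * Mod.nat t R.≈ 0ℤ → M ∣ s 0 + n * + t
      conclude (q , eq) = divides q (trans (cong (λ x → s 0 + n * x) (sym (nat-mod t))) (trans eq (ℤ.+-identityˡ _)))
      open LogDerivative (ℤ-mod M) (+ p) n t L
      unit : ∀ z → ∃[ v ] v * (1ℤ + + p * z) R.≈ 1ℤ
      unit z = ∤⇒inverse-mod-p^ pr (λ { (divides q eq) → p∤1 (divides (q - z) (isolate q eq)) }) N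
        where
        isolate : ∀ q → 1ℤ + + p * z ≡ q * + p → 1ℤ ≡ (q - z) * + p
        isolate q eq = trans (identity₁ (+ p) z) (trans (cong (_- + p * z) eq) (identity₂ q (+ p) z))
          where
          identity₁ : ∀ p z → 1ℤ ≡ 1ℤ + p * z - p * z
          identity₁ = solve-∀
          identity₂ : ∀ q p z → q * p - p * z ≡ (q - z) * p
          identity₂ = solve-∀
        p∤1 : ¬ (+ p ∣ 1ℤ)
        p∤1 p∣1 = contradiction (ℕ.∣1⇒≡1 (∣⇒∣ᵤ p∣1)) (ℕ.nonTrivial⇒≢1 {{prime⇒nonTrivial pr}})
      nilpotent : (+ p) ^ N R.≈ 0ℤ
      nilpotent = 1ℤ , trans (^-mod N) (sym (trans (ℤ.+-identityˡ _) (ℤ.*-identityˡ M)))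
      low′ : ∀ j → j ℕ.< t → ∃[ z ] g j R.≈ + p * z
      low′ j j<t with divides q eq ← low j j<t = q , ≡⇒≈ (trans eq (ℤ.*-comm q (+ p)))
      eqn′ : ∀ j → j ℕ.≤ L → Mod.conv g s j + n * (Mod.nat j * g j) R.≈ 0ℤ
      eqn′ j j≤L = ≡⇒≈ (trans (cong₂ (λ x y → x + n * (y * g j)) (conv-mod g s j) (nat-mod j)) (eqn j j≤L))

  -- The equation says that g is, up to X^L, a constant multiple of ∏ (1 - αᵢ X), where s j is n
  -- times the j-th power sum of the k numbers αᵢ.
  leading-divides : ∀ (n : ℤ) (k L N : ℕ) (s : ℕ → ℤ) → n ≢ 0ℤ → s 0 ≡ n * + k →
    ∣ n ∣ ℕ.* k ℕ.< 2 ℕ.^ N → N ℕ.* k ℕ.≤ L →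
    ∀ D → .{{_ : ℕ.NonZero D}} → (g : ℕ → ℤ) → g 0 ≡ + D → (∀ j → k ℕ.< j → g j ≡ 0ℤ) →
    (∀ j → j ℕ.≤ L → conv g s j + n * (+ j * g j) ≡ n * + k * g j) → ∀ j → + D ∣ g j
  leading-divides n k L N s n≢0 s₀≡nk nk<2^N Nk≤L = <-rec Claim go
    where
    -- Subtracting the constant n k from s absorbs the right side n k G, leaving G s′ = -n θ G, the
    -- form that `Stage` carries.
    s′ : ℕ → ℤ
    s′ j = s j + - (n * + k) * δ 0 j

    Claim : ℕ → Set
    Claim D = .{{_ : ℕ.NonZero D}} → (g : ℕ → ℤ) → g 0 ≡ + D → (∀ j → k ℕ.< j → g j ≡ 0ℤ) →
      (∀ j → j ℕ.≤ L → conv g s j + n * (+ j * g j) ≡ n * + k * g j) → ∀ j → + D ∣ g j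

    shifted : ∀ g → (∀ j → j ℕ.≤ L → conv g s j + n * (+ j * g j) ≡ n * + k * g j) →
      ∀ j → j ℕ.≤ L → conv g s′ j + n * (+ j * g j) ≡ 0ℤ
    shifted g eqn j j≤L = begin
      conv g s′ j + n * (+ j * g j)
        ≡⟨ cong (_+ n * (+ j * g j)) (trans (conv-comm g s′ j) (conv-distribʳ s _ g j)) ⟩
      conv s g j + conv (λ i → - (n * + k) * δ 0 i) g j + n * (+ j * g j)
        ≡⟨ cong₂ (λ x y → x + y + n * (+ j * g j)) (conv-comm s g j)
             (trans (conv-scaleˡ (- (n * + k)) (δ 0) g j) (cong (- (n * + k) *_) (conv-δ0 g j))) ⟩
      conv g s j + - (n * + k) * g j + n * (+ j * g j)
        ≡⟨ identity₁ (conv g s j) (n * + k) (g j) (n * (+ j * g j)) ⟩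
      conv g s j + n * (+ j * g j) - n * + k * g j
        ≡⟨ cong (_- n * + k * g j) (eqn j j≤L) ⟩
      n * + k * g j - n * + k * g j     ≡⟨ ℤ.+-inverseʳ (n * + k * g j) ⟩
      0ℤ ∎
      where
      open ≡-Reasoning
      identity₁ : ∀ x a b y → x + - a * b + y ≡ x + y - a * b
      identity₁ = solve-∀

    -- Every prime satisfies p^N ≥ 2^N, so an exponent N large enough for p = 2 serves all primes,
    -- and one bound L with it.
    no-large-divisor : ∀ {p t} → Prime p → 0 ℕ.< t → t ℕ.≤ k → ¬ (+ (p ℕ.^ N) ∣ n * + t)
    no-large-divisor {p} {t} pr 0<t t≤k p^N∣nt = ℕ.<⇒≱ nk<2^N (begin
      2 ℕ.^ N          ≤⟨ ℕ.^-monoˡ-≤ N (ℕ.nonTrivial⇒n>1 p {{prime⇒nonTrivial pr}}) ⟩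
      p ℕ.^ N          ≤⟨ ℕ.∣⇒≤ {{ℕ.m*n≢0 ∣ n ∣ t {{ℕ.≢-nonZero (λ e → n≢0 (ℤ.∣i∣≡0⇒i≡0 e))}} {{ℕ.>-nonZero 0<t}}}}
                            (subst (p ℕ.^ N ℕ.∣_) (ℤ.abs-* n (+ t)) (∣⇒∣ᵤ p^N∣nt)) ⟩
      ∣ n ∣ ℕ.* t      ≤⟨ ℕ.*-monoʳ-≤ ∣ n ∣ t≤k ⟩
      ∣ n ∣ ℕ.* k      ∎)
      where open ℕ.≤-Reasoning

    -- Strong induction on D. A prime factor p of D that divides all of g is cancelled from g and D
    -- together, as the equation is linear in g; otherwise the first index t with `g t` prime to p
    -- leads to a contradiction.
    go : ∀ D → (∀ {D′} → D′ ℕ.< D → Claim D′) → Claim D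
    go 1 rec g g₀≡D high eqn j = divides (g j) (sym (ℤ.*-identityʳ (g j)))
    go D@(suc (suc _)) rec g g₀≡D high eqn with prime-divisor D (s≤s (s≤s z≤n))
    ... | p , pr , ℕ.divides D′ D≡D′p with first-nondivisible (+ p) g (suc k)
    ... | inj₂ (t , s≤s t≤k , p∤gt , low) =
      contradiction p^N∣nt (no-large-divisor pr (ℕ.n≢0⇒n>0 t≢0) t≤k)
      where
      -- p divides `g 0` = D, which rules out t = 0; for t = 0 the divisibility of `n * + t` by p^N
      -- would be no contradiction.
      t≢0 : t ≢ 0
      t≢0 refl = p∤gt (divides (+ D′) (trans g₀≡D (trans (cong +_ D≡D′p) (ℤ.pos-* D′ p))))
      identity : ∀ x → x + - x * 1ℤ ≡ 0ℤ
      identity = solve-∀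
      s′₀≡0 : s′ 0 ≡ 0ℤ
      s′₀≡0 = trans (cong (_+ - (n * + k) * 1ℤ) s₀≡nk) (identity (n * + k))
      p^N∣nt : + (p ℕ.^ N) ∣ n * + t
      p^N∣nt = subst (+ (p ℕ.^ N) ∣_) (trans (cong (_+ n * + t) s′₀≡0) (ℤ.+-identityˡ (n * + t)))
        (log-derivative-ℤ pr N n (ℕ.≤-trans (ℕ.*-monoʳ-≤ N t≤k) Nk≤L) g s′ low p∤gt (shifted g eqn))
    ... | inj₁ all = λ j → descend j (rec D′<D {{D′≢0}} g′ g′₀≡D′ high′ eqn′ j)
      where
      instance
        p≢0 : ℕ.NonZero p
        p≢0 = prime⇒nonZero pr
        D′≢0 : ℕ.NonZero D′
        D′≢0 = ℕ.≢-nonZero λ { refl → ℕ.1+n≢0 D≡D′p }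
      D′<D : D′ ℕ.< D
      D′<D = subst (D′ ℕ.<_) (sym D≡D′p) (ℕ.m<m*n D′ p (ℕ.nonTrivial⇒n>1 p {{prime⇒nonTrivial pr}}))
      p∣g : ∀ j → + p ∣ g j
      p∣g j with ℕ.<-≤-connex j (suc k)
      ... | inj₁ j≤k = all j j≤k
      ... | inj₂ k<j = divides 0ℤ (high j k<j)
      g′ : ℕ → ℤ
      g′ j = _∣_.quotient (p∣g j)
      g≡g′p : ∀ j → g j ≡ g′ j * + p
      g≡g′p j = _∣_.equality (p∣g j)
      cancel : ∀ {x y} → x * + p ≡ y * + p → x ≡ y
      cancel {x} {y} = ℤ.*-cancelʳ-≡ x y (+ p)
      g′₀≡D′ : g′ 0 ≡ + D′
      g′₀≡D′ = cancel (trans (sym (g≡g′p 0)) (trans g₀≡D (trans (cong +_ D≡D′p) (ℤ.pos-* D′ p))))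
      high′ : ∀ j → k ℕ.< j → g′ j ≡ 0ℤ
      high′ j k<j = cancel (trans (sym (g≡g′p j)) (high j k<j))
      eqn′ : ∀ j → j ℕ.≤ L → conv g′ s j + n * (+ j * g′ j) ≡ n * + k * g′ j
      eqn′ j j≤L = cancel (begin
        (conv g′ s j + n * (+ j * g′ j)) * + p     ≡⟨ identity₁ (conv g′ s j) n (+ j) (g′ j) (+ p) ⟩
        + p * conv g′ s j + n * (+ j * (g′ j * + p))
          ≡⟨ cong₂ (λ x y → x + n * (+ j * y)) (sym (conv-scaleˡ (+ p) g′ s j)) (sym (g≡g′p j)) ⟩
        conv (λ i → + p * g′ i) s j + n * (+ j * g j)
          ≡⟨ cong (_+ n * (+ j * g j)) (conv-cong j
               (λ i _ → trans (ℤ.*-comm (+ p) (g′ i)) (sym (g≡g′p i))) (λ _ _ → refl)) ⟩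
        conv g s j + n * (+ j * g j)               ≡⟨ eqn j j≤L ⟩
        n * + k * g j                              ≡⟨ cong (n * + k *_) (g≡g′p j) ⟩
        n * + k * (g′ j * + p)                     ≡⟨ ℤ.*-assoc (n * + k) (g′ j) (+ p) ⟨
        n * + k * g′ j * + p                       ∎)
        where
        open ≡-Reasoning
        identity₁ : ∀ c n j g p → (c + n * (j * g)) * p ≡ p * c + n * (j * (g * p))
        identity₁ = solve-∀
      descend : ∀ j → + D′ ∣ g′ j → + D ∣ g j
      descend j (divides q eq) = divides q (begin
        g j                  ≡⟨ g≡g′p j ⟩
        g′ j * + p           ≡⟨ cong (_* + p) eq ⟩
        q * + D′ * + p       ≡⟨ ℤ.*-assoc q (+ D′) (+ p) ⟩
        q * (+ D′ * + p)     ≡⟨ cong (q *_) (ℤ.pos-* D′ p) ⟨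
        q * + (D′ ℕ.* p)     ≡⟨ cong (λ x → q * + x) D≡D′p ⟨
        q * + D              ∎)
        where open ≡-Reasoning

-- Integers inside ℚ, common denominators and the logarithm.

module _ where
  open ≡ using (refl; sym; trans; cong; cong₂; subst; module ≡-Reasoning)

  -- ℚ keeps fractions in lowest terms, which hampers computation; identities for `fromℤ` are
  -- checked on unnormalised fractions with denominator 1.
  toℚᵘ-fromℤ : ∀ z → ℚ.toℚᵘ (fromℤ z) ℚᵘ.≃ mkℚᵘ z 0
  toℚᵘ-fromℤ z = ℚ.toℚᵘ-fromℚᵘ (mkℚᵘ z 0)

  fromℤ-injective : ∀ {x y} → fromℤ x ≡ fromℤ y → x ≡ y
  fromℤ-injective {x} {y} eq
    with *≡* x*1≡y*1 ← ℚᵘ.≃-trans (ℚᵘ.≃-sym (toℚᵘ-fromℤ x)) (ℚᵘ.≃-trans (ℚ.toℚᵘ-cong eq) (toℚᵘ-fromℤ y)) =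
    trans (sym (ℤ.*-identityʳ x)) (trans x*1≡y*1 (ℤ.*-identityʳ y))

  fromℤ-+ : ∀ x y → fromℤ (x ℤ.+ y) ≡ fromℤ x ℚ.+ fromℤ y
  fromℤ-+ x y = ℚ.toℚᵘ-injective (begin
    ℚ.toℚᵘ (fromℤ (x ℤ.+ y))                      ≈⟨ toℚᵘ-fromℤ (x ℤ.+ y) ⟩
    mkℚᵘ (x ℤ.+ y) 0                              ≈⟨ *≡* (identity x y) ⟩
    mkℚᵘ x 0 ℚᵘ.+ mkℚᵘ y 0                        ≈⟨ ℚᵘ.+-cong (toℚᵘ-fromℤ x) (toℚᵘ-fromℤ y) ⟨
    ℚ.toℚᵘ (fromℤ x) ℚᵘ.+ ℚ.toℚᵘ (fromℤ y)        ≈⟨ ℚ.toℚᵘ-homo-+ (fromℤ x) (fromℤ y) ⟨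
    ℚ.toℚᵘ (fromℤ x ℚ.+ fromℤ y)                  ∎)
    where
    open ℚᵘ.≃-Reasoning
    identity : ∀ x y → (x ℤ.+ y) ℤ.* 1ℤ ≡ (x ℤ.* 1ℤ ℤ.+ y ℤ.* 1ℤ) ℤ.* 1ℤ
    identity = solve-∀

  fromℤ-* : ∀ x y → fromℤ (x ℤ.* y) ≡ fromℤ x ℚ.* fromℤ y
  fromℤ-* x y = ℚ.toℚᵘ-injective (begin
    ℚ.toℚᵘ (fromℤ (x ℤ.* y))                      ≈⟨ toℚᵘ-fromℤ (x ℤ.* y) ⟩
    mkℚᵘ x 0 ℚᵘ.* mkℚᵘ y 0                        ≈⟨ ℚᵘ.*-cong (toℚᵘ-fromℤ x) (toℚᵘ-fromℤ y) ⟨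
    ℚ.toℚᵘ (fromℤ x) ℚᵘ.* ℚ.toℚᵘ (fromℤ y)        ≈⟨ ℚ.toℚᵘ-homo-* (fromℤ x) (fromℤ y) ⟨
    ℚ.toℚᵘ (fromℤ x ℚ.* fromℤ y)                  ∎)
    where open ℚᵘ.≃-Reasoning

  fromℤ-sum : ∀ {n} (v : Fin n → ℤ) → fromℤ (ℤ-Sum.sum v) ≡ ℚ-Sum.sum (λ i → fromℤ (v i))
  fromℤ-sum {zero}  v = refl
  fromℤ-sum {suc n} v = trans (fromℤ-+ (v zero) (ℤ-Sum.sum (λ i → v (suc i))))
    (cong (fromℤ (v zero) ℚ.+_) (fromℤ-sum (λ i → v (suc i))))

  fromℤ-conv : ∀ f g j → fromℤ (ℤ-Seq.conv f g j) ≡ ℚ-Seq.conv (λ i → fromℤ (f i)) (λ i → fromℤ (g i)) j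
  fromℤ-conv f g zero    = fromℤ-* (f 0) (g 0)
  fromℤ-conv f g (suc j) = trans (fromℤ-+ (f 0 ℤ.* g (suc j)) (ℤ-Seq.conv (λ i → f (suc i)) g j))
    (cong₂ ℚ._+_ (fromℤ-* (f 0) (g (suc j))) (fromℤ-conv (λ i → f (suc i)) g j))

  nat≡fromℤ : ∀ m → ℚ-Seq.nat m ≡ fromℤ (+ m)
  nat≡fromℤ zero    = refl
  nat≡fromℤ (suc m) = trans (cong (1ℚ ℚ.+_) (nat≡fromℤ m)) (sym (fromℤ-+ 1ℤ (+ m)))

  nat-injective : ∀ {m n} → ℚ-Seq.nat m ≡ ℚ-Seq.nat n → m ≡ n
  nat-injective {m} {n} eq =
    ℤ.+-injective (fromℤ-injective (trans (sym (nat≡fromℤ m)) (trans eq (nat≡fromℤ n))))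

  nat-+ : ∀ m n → ℚ-Seq.nat (m ℕ.+ n) ≡ ℚ-Seq.nat m ℚ.+ ℚ-Seq.nat n
  nat-+ m n = trans (nat≡fromℤ (m ℕ.+ n)) (trans (fromℤ-+ (+ m) (+ n))
    (sym (cong₂ ℚ._+_ (nat≡fromℤ m) (nat≡fromℤ n))))

  nat-* : ∀ m n → ℚ-Seq.nat (m ℕ.* n) ≡ ℚ-Seq.nat m ℚ.* ℚ-Seq.nat n
  nat-* m n = trans (nat≡fromℤ (m ℕ.* n)) (trans (cong fromℤ (ℤ.pos-* m n))
    (trans (fromℤ-* (+ m) (+ n)) (sym (cong₂ ℚ._*_ (nat≡fromℤ m) (nat≡fromℤ n)))))

  denominator-clears : ∀ q → fromℤ (ℚ.↧ q) ℚ.* q ≡ fromℤ (ℚ.↥ q)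
  denominator-clears q@(ℚ.mkℚ n d-1 _) = ℚ.toℚᵘ-injective (begin
    ℚ.toℚᵘ (fromℤ (ℚ.↧ q) ℚ.* q)                ≈⟨ ℚ.toℚᵘ-homo-* (fromℤ (ℚ.↧ q)) q ⟩
    ℚ.toℚᵘ (fromℤ (ℚ.↧ q)) ℚᵘ.* ℚ.toℚᵘ q        ≈⟨ ℚᵘ.*-congʳ (toℚᵘ-fromℤ (ℚ.↧ q)) ⟩
    mkℚᵘ (ℚ.↧ q) 0 ℚᵘ.* ℚ.toℚᵘ q                ≈⟨ *≡* (trans (identity (ℚ.↧ q) n)
                                                      (cong (λ x → n ℤ.* + suc x) (sym (ℕ.+-identityʳ d-1)))) ⟩
    mkℚᵘ n 0                                    ≈⟨ toℚᵘ-fromℤ n ⟨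
    ℚ.toℚᵘ (fromℤ n)                            ∎)
    where
    open ℚᵘ.≃-Reasoning
    identity : ∀ x y → x ℤ.* y ℤ.* 1ℤ ≡ y ℤ.* x
    identity = solve-∀

  common-denominator : ∀ (q : ℕ → ℚ) m →
    ∃[ D ] ℕ.NonZero D × (∀ j → j ℕ.< m → IsInteger (fromℤ (+ D) ℚ.* q j))
  common-denominator q zero    = 1 , _ , λ _ ()
  common-denominator q (suc m) with D , D≢0 , int ← common-denominator q m =
    D ℕ.* ℚ.↧ₙ (q m) , ℕ.m*n≢0 D (ℚ.↧ₙ (q m)) {{D≢0}} , λ j j<1+m → cases (ℕ.m<1+n⇒m<n∨m≡n j<1+m)
    where
    open ≡-Reasoning
    expand : ∀ q′ → fromℤ (+ (D ℕ.* ℚ.↧ₙ (q m))) ℚ.* q′ ≡ fromℤ (+ D) ℚ.* (fromℤ (ℚ.↧ (q m)) ℚ.* q′)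
    expand q′ = trans (cong (λ x → fromℤ x ℚ.* q′) (ℤ.pos-* D (ℚ.↧ₙ (q m))))
      (trans (cong (ℚ._* q′) (fromℤ-* (+ D) (ℚ.↧ (q m)))) (ℚ.*-assoc (fromℤ (+ D)) (fromℤ (ℚ.↧ (q m))) q′))
    cases : ∀ {j} → j ℕ.< m ⊎ j ≡ m → IsInteger (fromℤ (+ (D ℕ.* ℚ.↧ₙ (q m))) ℚ.* q j)
    cases {j} (inj₁ j<m) with z , eq ← int j j<m = ℚ.↧ (q m) ℤ.* z , (begin
      fromℤ (+ (D ℕ.* ℚ.↧ₙ (q m))) ℚ.* q j               ≡⟨ expand (q j) ⟩
      fromℤ (+ D) ℚ.* (fromℤ (ℚ.↧ (q m)) ℚ.* q j)        ≡⟨ ℚ.*-assoc (fromℤ (+ D)) (fromℤ (ℚ.↧ (q m))) (q j) ⟨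
      fromℤ (+ D) ℚ.* fromℤ (ℚ.↧ (q m)) ℚ.* q j
        ≡⟨ cong (ℚ._* q j) (ℚ.*-comm (fromℤ (+ D)) (fromℤ (ℚ.↧ (q m)))) ⟩
      fromℤ (ℚ.↧ (q m)) ℚ.* fromℤ (+ D) ℚ.* q j          ≡⟨ ℚ.*-assoc (fromℤ (ℚ.↧ (q m))) (fromℤ (+ D)) (q j) ⟩
      fromℤ (ℚ.↧ (q m)) ℚ.* (fromℤ (+ D) ℚ.* q j)        ≡⟨ cong (fromℤ (ℚ.↧ (q m)) ℚ.*_) eq ⟩
      fromℤ (ℚ.↧ (q m)) ℚ.* fromℤ z                      ≡⟨ fromℤ-* (ℚ.↧ (q m)) z ⟨
      fromℤ (ℚ.↧ (q m) ℤ.* z)                            ∎)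
    cases (inj₂ refl) = + D ℤ.* ℚ.↥ (q m) , (begin
      fromℤ (+ (D ℕ.* ℚ.↧ₙ (q m))) ℚ.* q m               ≡⟨ expand (q m) ⟩
      fromℤ (+ D) ℚ.* (fromℤ (ℚ.↧ (q m)) ℚ.* q m)        ≡⟨ cong (fromℤ (+ D) ℚ.*_) (denominator-clears (q m)) ⟩
      fromℤ (+ D) ℚ.* fromℤ (ℚ.↥ (q m))                  ≡⟨ fromℤ-* (+ D) (ℚ.↥ (q m)) ⟨
      fromℤ (+ D ℤ.* ℚ.↥ (q m))                          ∎)

  -- Otherwise monotonicity of the logarithm would give 1 + ⌊log₂ m⌋ ≤ ⌊log₂ m⌋.
  m<2^[1+⌊log₂m⌋] : ∀ m → m ℕ.< 2 ℕ.^ suc ⌊log₂ m ⌋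
  m<2^[1+⌊log₂m⌋] m = ℕ.≰⇒> λ 2^l≤m → ℕ.1+n≰n
    (subst (ℕ._≤ ⌊log₂ m ⌋) (⌊log₂[2^n]⌋≡n (suc ⌊log₂ m ⌋)) (⌊log₂⌋-mono-≤ 2^l≤m))

-- Horner's scheme and monic polynomials.

module Horner {a ℓ} (R : CommutativeRing a ℓ) where
  open CommutativeRing R hiding (zero)
  open Exp semiring using (_^_)
  open Sequences R using (nat)
  open SemiringSolver commutativeSemiring using (solve; con; _:=_; _:+_; _:*_)

  -- g 0 xⁿ⁻¹ + g 1 xⁿ⁻² + ⋯ + g (n - 1)
  horner : ℕ → (ℕ → Carrier) → Carrier → Carrier
  horner zero    g x = 0#
  horner (suc n) g x = x * horner n g x + g n

  horner-cong : ∀ n {f g} x → (∀ j → j ℕ.< n → f j ≈ g j) → horner n f x ≈ horner n g x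
  horner-cong zero    x eq = refl
  horner-cong (suc n) x eq =
    +-cong (*-congˡ (horner-cong n x (λ j j<n → eq j (ℕ.m<n⇒m<1+n j<n)))) (eq n (ℕ.n<1+n n))

  horner-+ : ∀ n f g x → horner n (λ j → f j + g j) x ≈ horner n f x + horner n g x
  horner-+ zero    f g x = sym (+-identityˡ 0#)
  horner-+ (suc n) f g x = trans (+-congʳ (*-congˡ (horner-+ n f g x)))
    (solve 5 (λ x a b c d → x :* (a :+ b) :+ (c :+ d) := (x :* a :+ c) :+ (x :* b :+ d))
      refl x _ _ _ _)

  horner-scale : ∀ n c f x → horner n (λ j → c * f j) x ≈ c * horner n f x
  horner-scale zero    c f x = sym (zeroʳ c)
  horner-scale (suc n) c f x = trans (+-congʳ (*-congˡ (horner-scale n c f x)))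
    (solve 4 (λ x c a b → x :* (c :* a) :+ c :* b := c :* (x :* a :+ b)) refl x c _ _)

  horner-zero : ∀ n {f} x → (∀ j → j ℕ.< n → f j ≈ 0#) → horner n f x ≈ 0#
  horner-zero zero    x eq = refl
  horner-zero (suc n) x eq =
    trans (+-cong (trans (*-congˡ (horner-zero n x (λ j j<n → eq j (ℕ.m<n⇒m<1+n j<n)))) (zeroʳ x))
                  (eq n (ℕ.n<1+n n)))
          (+-identityˡ 0#)

  horner-cons : ∀ n g x → horner (suc n) g x ≈ g 0 * x ^ n + horner n (g ∘ suc) x
  horner-cons zero    g x = solve 2 (λ x g → x :* con 0 :+ g := g :* con 1 :+ con 0) refl x (g 0)
  horner-cons (suc n) g x = trans (+-congʳ (*-congˡ (horner-cons n g x)))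
    (solve 5 (λ x g p h c → x :* (g :* p :+ h) :+ c := g :* (x :* p) :+ (x :* h :+ c))
      refl x (g 0) (x ^ n) _ _)

  horner-zeroˡ : ∀ n g x → g 0 ≈ 0# → horner (suc n) g x ≈ horner n (g ∘ suc) x
  horner-zeroˡ n g x g₀ = trans (horner-cons n g x)
    (trans (+-congʳ (trans (*-congʳ g₀) (zeroˡ _))) (+-identityˡ _))

  -- Iterating Horner's scheme evaluates the derivative.
  horner-horner : ∀ n f x → horner n (λ j → horner (suc j) f x) x ≈
                  horner n (λ j → nat (n ℕ.∸ j) * f j) x
  horner-horner zero    f x = refl
  horner-horner (suc n) f x = begin
    x * horner n (λ j → horner (suc j) f x) x + (x * horner n f x + f n)
      ≈⟨ +-congʳ (*-congˡ (horner-horner n f x)) ⟩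
    x * horner n (λ j → nat (n ℕ.∸ j) * f j) x + (x * horner n f x + f n)
      ≈⟨ solve 4 (λ x a b c → x :* a :+ (x :* b :+ c) := x :* (a :+ b) :+ c) refl x _ _ _ ⟩
    x * (horner n (λ j → nat (n ℕ.∸ j) * f j) x + horner n f x) + f n
      ≈⟨ +-cong (*-congˡ (sym (horner-+ n _ f x))) (sym (trans (*-congʳ nat-1) (*-identityˡ _))) ⟩
    x * horner n (λ j → nat (n ℕ.∸ j) * f j + f j) x + nat (suc n ℕ.∸ n) * f n
      ≈⟨ +-congʳ (*-congˡ (horner-cong n x step)) ⟩
    x * horner n (λ j → nat (suc n ℕ.∸ j) * f j) x + nat (suc n ℕ.∸ n) * f n ∎
    where
    open SetoidReasoning setoid
    nat-1 : nat (suc n ℕ.∸ n) ≈ 1#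
    nat-1 = trans (reflexive (≡.cong nat (ℕ.m+n∸n≡m 1 n))) (+-identityʳ 1#)
    step : ∀ j → j ℕ.< n → nat (n ℕ.∸ j) * f j + f j ≈ nat (suc n ℕ.∸ j) * f j
    step j j<n = trans (solve 2 (λ m y → m :* y :+ y := (con 1 :+ m) :* y) refl _ _)
      (*-congʳ (reflexive (≡.cong nat (≡.sym (ℕ.+-∸-assoc 1 (ℕ.<⇒≤ j<n))))))

-- `horner` reads the leading coefficient first, a coefficient list the constant term first; this is
-- the passage between the two orders.
polyOf : ∀ {a} {A : Set a} → ℕ → (ℕ → A) → List A
polyOf zero    q = []
polyOf (suc n) q = q n ∷ polyOf n q

map-polyOf : ∀ {a b} {A : Set a} {B : Set b} (f : A → B) n q → map f (polyOf n q) ≡ polyOf n (f ∘ q)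
map-polyOf f zero    q = ≡.refl
map-polyOf f (suc n) q = ≡.cong (f (q n) ∷_) (map-polyOf f n q)

module _ {a ℓ} (R : CommutativeRing a ℓ) where
  open Polynomial R using (coeff; MonicOfDegree)
  open CommutativeRing R using (_≈_; 0#; 1#; reflexive; trans)

  coeff-polyOf-≥ : ∀ n q {m} → n ℕ.≤ m → coeff (polyOf n q) m ≡ 0#
  coeff-polyOf-≥ zero    q         _         = ≡.refl
  coeff-polyOf-≥ (suc n) q {suc m} (s≤s n≤m) = coeff-polyOf-≥ n q n≤m

  coeff-polyOf-top : ∀ n q → coeff (polyOf (suc n) q) n ≡ q 0
  coeff-polyOf-top zero    q = ≡.refl
  coeff-polyOf-top (suc n) q = coeff-polyOf-top n q

  polyOf-monic : ∀ n q → q 0 ≈ 1# → MonicOfDegree n (polyOf (suc n) q)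
  polyOf-monic n q q₀≈1 = trans (reflexive (coeff-polyOf-top n q)) q₀≈1 ,
    λ m n<m → reflexive (coeff-polyOf-≥ (suc n) q n<m)

*-inverseˡ-≢0 : ∀ {q} → q ≢ 0ℚ → ∃[ u ] u ℚ.* q ≡ 1ℚ
*-inverseˡ-≢0 {q} q≢0 = ℚ.1/ q , ℚ.*-inverseˡ q
  where instance _ = ℚ.≢-nonZero q≢0

-- Arithmetic in ℚ(α), carried out at all roots of a polynomial simultaneously.

module MinimalPolynomials {c ℓ₁ ℓ₂} (K : FieldExtensionOfℚ c ℓ₁ ℓ₂) where
  open FieldExtensionOfℚ K hiding (zero)
  open Extension K using (module K[X]; ιₚ; IsRoot; IsMinimalPolynomial; IsGaloisOverℚ)
  open RingProperties ring
  open Horner commutativeRing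
  open SemiringSolver commutativeSemiring using (solve; _:=_; _:+_; _:*_)
  open RingMorphisms.IsRingHomomorphism ι-isRingHomomorphism public
    renaming (⟦⟧-cong to ι-cong; +-homo to ι-+; *-homo to ι-*; 0#-homo to ι-0; 1#-homo to ι-1;
              -‿homo to ι-neg)
    using ()

  ι-nat : ∀ m → ι (ℚ-Seq.nat m) ≈ Sequences.nat commutativeRing m
  ι-nat zero    = ι-0
  ι-nat (suc m) = trans (ι-+ _ _) (+-cong ι-1 (ι-nat m))

  eval-polyOf : ∀ n q x → K[X].eval (ιₚ (polyOf n q)) x ≈ horner n (ι ∘ q) x
  eval-polyOf zero    q x = refl
  eval-polyOf (suc n) q x = trans (+-comm _ _) (+-congʳ (*-congˡ (eval-polyOf n q x)))

  eval-zero : ∀ p x → (∀ m → ℚ[X].coeff p m ≡ 0ℚ) → K[X].eval (ιₚ p) x ≈ 0#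
  eval-zero []      x eq = refl
  eval-zero (a ∷ p) x eq = trans (+-cong (trans (ι-cong (eq 0)) ι-0)
    (trans (*-congˡ (eval-zero p x (eq ∘ suc))) (zeroʳ x))) (+-identityˡ 0#)

  eval-horner : ∀ p k x → (∀ m → k ℕ.< m → ℚ[X].coeff p m ≡ 0ℚ) →
    K[X].eval (ιₚ p) x ≈ horner (suc k) (λ j → ι (ℚ[X].coeff p (k ℕ.∸ j))) x
  eval-horner []      k       x eq = sym (horner-zero (suc k) x (λ _ _ → ι-0))
  eval-horner (a ∷ p) zero    x eq = trans (+-congˡ (*-congˡ
    (eval-zero p x (λ m → eq (suc m) (s≤s z≤n))))) (+-comm _ _)
  eval-horner (a ∷ p) (suc k) x eq = trans (+-comm _ _) (+-cong
    (*-congˡ (trans (eval-horner p k x (λ m k<m → eq (suc m) (s≤s k<m)))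
      (horner-cong (suc k) x λ { j (s≤s j≤k) →
        ι-cong (≡.cong (ℚ[X].coeff (a ∷ p)) (≡.sym (ℕ.+-∸-assoc 1 j≤k))) })))
    (ι-cong (≡.cong (ℚ[X].coeff (a ∷ p)) (≡.sym (ℕ.n∸n≡0 k)))))

  -- The powers of α below k are independent over ℚ. A nonzero leading coefficient could be scaled
  -- to 1, giving a monic polynomial of degree below k that vanishes at α. Zero leading
  -- coefficients, decidable in ℚ, are dropped one at a time.
  horner-independent : ∀ {α k} → (∀ q n → ℚ[X].MonicOfDegree n q → IsRoot q α → k ℕ.≤ n) →
    ∀ n q → n ℕ.≤ k → horner n (ι ∘ q) α ≈ 0# → ∀ j → j ℕ.< n → q j ≡ 0ℚ
  horner-independent {α} {k} minimal (suc n) q n<k eq j j<n with q 0 ℚ.≟ 0ℚ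
  ... | yes q₀≡0 = cases j j<n
    where
    cases : ∀ j → j ℕ.< suc n → q j ≡ 0ℚ
    cases zero    _         = q₀≡0
    cases (suc j) (s≤s j<n) = horner-independent minimal n (q ∘ suc) (ℕ.<⇒≤ n<k)
      (trans (sym (horner-zeroˡ n (ι ∘ q) α (trans (ι-cong q₀≡0) ι-0))) eq) j j<n
  ... | no q₀≢0 with u , uq₀≡1 ← *-inverseˡ-≢0 q₀≢0 =
    contradiction n<k (ℕ.≤⇒≯ (minimal (polyOf (suc n) (λ i → u ℚ.* q i)) n
      (polyOf-monic ℚ.+-*-commutativeRing n _ uq₀≡1)
      (trans (eval-polyOf (suc n) _ α) (trans (horner-cong (suc n) α (λ j _ → ι-* u (q j)))
        (trans (horner-scale (suc n) (ι u) (ι ∘ q) α) (trans (*-congˡ eq) (zeroʳ _)))))))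

  -- Tightness says that y is 0 once y # 0 is refuted. So a nonzero y is invertible up to double
  -- negation, which suffices where a contradiction is sought.
  nonzero⇒¬¬invertible : ∀ {y} → ¬ (y ≈ 0#) → ¬ ¬ (∃[ z ] z * y ≈ 1#)
  nonzero⇒¬¬invertible {y} y≉0 ¬inv = y≉0 (proj₁ (F.tight y 0#) λ y#0 → ¬inv (invert (F.#⇒invertible y#0)))
    where
    module F = HeytingField heytingField
    invert : ∃[ z ] z * (y - 0#) ≈ 1# × (y - 0#) * z ≈ 1# → ∃[ z ] z * y ≈ 1#
    invert (z , zy , _) = z , trans (*-congˡ (sym (trans (+-congˡ -0#≈0#) (+-identityʳ y)))) zy

  -- The roots of Xᵏ + G 1 Xᵏ⁻¹ + ⋯ + G k, where k = suc k′.
  module Roots (k′ : ℕ) (G : ℕ → ℚ) (G₀≡1 : G 0 ≡ 1ℚ) where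
    k : ℕ
    k = suc k′

    Root : Carrier → Set ℓ₁
    Root x = horner (suc k) (ι ∘ G) x ≈ 0#

    -- The companion matrix: multiply by x, then remove the x^k term by subtracting q 0 times the
    -- polynomial. `trunc` supplies the 0 that is shifted in at the last place.
    mulX : (ℕ → ℚ) → ℕ → ℚ
    mulX q j = ℚ-Seq.trunc k q (suc j) ℚ.+ ℚ.- q 0 ℚ.* G (suc j)

    horner-mulX : ∀ {x} → Root x → ∀ q → x * horner k (ι ∘ q) x ≈ horner k (ι ∘ mulX q) x
    horner-mulX {x} root q = begin
      x * horner k (ι ∘ q) x
        ≈⟨ *-congˡ (horner-cong k x (λ j j<k → ι-cong (≡.sym (ℚ-Seq.trunc-< k q j<k)))) ⟩
      x * horner k (ι ∘ t) x
        ≈⟨ +-identityʳ _ ⟨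
      x * horner k (ι ∘ t) x + 0#
        ≈⟨ +-cong refl (trans (ι-cong (ℚ-Seq.trunc-≥ k q ℕ.≤-refl)) ι-0) ⟨
      horner (suc k) (ι ∘ t) x
        ≈⟨ trans (+-congˡ (trans (*-congˡ root) (zeroʳ _))) (+-identityʳ _) ⟨
      horner (suc k) (ι ∘ t) x + ι (ℚ.- q 0) * horner (suc k) (ι ∘ G) x
        ≈⟨ +-congˡ (horner-scale (suc k) _ (ι ∘ G) x) ⟨
      horner (suc k) (ι ∘ t) x + horner (suc k) (λ j → ι (ℚ.- q 0) * ι (G j)) x
        ≈⟨ horner-+ (suc k) _ _ x ⟨
      horner (suc k) (λ j → ι (t j) + ι (ℚ.- q 0) * ι (G j)) x
        ≈⟨ horner-cong (suc k) x (λ j _ → trans (ι-+ _ _) (+-congˡ (ι-* _ _))) ⟨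
      horner (suc k) (λ j → ι (t j ℚ.+ ℚ.- q 0 ℚ.* G j)) x
        ≈⟨ horner-zeroˡ k _ x (trans (ι-cong leading) ι-0) ⟩
      horner k (ι ∘ mulX q) x ∎
      where
      open SetoidReasoning setoid
      t = ℚ-Seq.trunc k q
      leading : q 0 ℚ.+ ℚ.- q 0 ℚ.* G 0 ≡ 0ℚ
      leading = ≡.trans (≡.cong (λ g → q 0 ℚ.+ ℚ.- q 0 ℚ.* g) G₀≡1)
        (≡.trans (≡.cong (q 0 ℚ.+_) (ℚ.*-identityʳ _)) (ℚ.+-inverseʳ (q 0)))

    -- The same q has to serve all roots. This uniformity is what carries an equation from α to its
    -- conjugates.
    PolynomialOnRoots : (Carrier → Carrier) → Set (c ⊔ ℓ₁)
    PolynomialOnRoots f = ∃[ q ] ∀ x → Root x → f x ≈ horner k (ι ∘ q) x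

    poly-const : ∀ a → PolynomialOnRoots (λ _ → ι a)
    poly-const a = q , λ x _ → trans (sym (+-identityˡ _)) (+-cong
        (sym (trans (*-congˡ (horner-zero k′ x (λ j j<k′ → trans (ι-cong (q-< j<k′)) ι-0))) (zeroʳ x)))
        (ι-cong (≡.sym (q-k′ k′))))
      where
      q : ℕ → ℚ
      q j = a ℚ.* ℚ-Seq.δ k′ j
      δ-< : ∀ {i j} → j ℕ.< i → ℚ-Seq.δ i j ≡ 0ℚ
      δ-< {suc i} {zero}  _         = ≡.refl
      δ-< {suc i} {suc j} (s≤s j<i) = δ-< j<i
      q-< : ∀ {j} → j ℕ.< k′ → q j ≡ 0ℚ
      q-< j<k′ = ≡.trans (≡.cong (a ℚ.*_) (δ-< j<k′)) (ℚ.*-zeroʳ a)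
      δ-≡ : ∀ i → ℚ-Seq.δ i i ≡ 1ℚ
      δ-≡ zero    = ≡.refl
      δ-≡ (suc i) = δ-≡ i
      q-k′ : ∀ i → a ℚ.* ℚ-Seq.δ i i ≡ a
      q-k′ i = ≡.trans (≡.cong (a ℚ.*_) (δ-≡ i)) (ℚ.*-identityʳ a)

    poly-+ : ∀ {f g} → PolynomialOnRoots f → PolynomialOnRoots g → PolynomialOnRoots (λ x → f x + g x)
    poly-+ (q , f≈) (r , g≈) = (λ j → q j ℚ.+ r j) , λ x root →
      trans (+-cong (f≈ x root) (g≈ x root)) (trans (sym (horner-+ k _ _ x))
        (horner-cong k x (λ j _ → sym (ι-+ _ _))))

    poly-X* : ∀ {f} → PolynomialOnRoots f → PolynomialOnRoots (λ x → x * f x)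
    poly-X* (q , f≈) = mulX q , λ x root → trans (*-congˡ (f≈ x root)) (horner-mulX root q)

    poly-ι* : ∀ a {f} → PolynomialOnRoots f → PolynomialOnRoots (λ x → ι a * f x)
    poly-ι* a (q , f≈) = (λ j → a ℚ.* q j) , λ x root → trans (*-congˡ (f≈ x root))
      (trans (sym (horner-scale k (ι a) _ x)) (horner-cong k x (λ j _ → sym (ι-* _ _))))

    poly-resp : ∀ {f g} → (∀ x → Root x → f x ≈ g x) → PolynomialOnRoots f → PolynomialOnRoots g
    poly-resp f≈g (q , f≈) = q , λ x root → trans (sym (f≈g x root)) (f≈ x root)

    poly-horner* : ∀ n q {g} → PolynomialOnRoots g → PolynomialOnRoots (λ x → horner n (ι ∘ q) x * g x)
    poly-horner* zero    q pg = poly-resp (λ x _ → trans ι-0 (sym (zeroˡ _))) (poly-const 0ℚ)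
    poly-horner* (suc n) q {g} pg = poly-resp
      (λ x _ → solve 4 (λ x h g a → x :* (h :* g) :+ a :* g := (x :* h :+ a) :* g)
        refl x (horner n (ι ∘ q) x) (g x) (ι (q n)))
      (poly-+ (poly-X* (poly-horner* n q pg)) (poly-ι* (q n) pg))

    poly-* : ∀ {f g} → PolynomialOnRoots f → PolynomialOnRoots g → PolynomialOnRoots (λ x → f x * g x)
    poly-* (q , f≈) pg = poly-resp (λ x root → *-congʳ (sym (f≈ x root))) (poly-horner* k q pg)

    poly-eval : ∀ p {f} → PolynomialOnRoots f → PolynomialOnRoots (λ x → K[X].eval (ιₚ p) (f x))
    poly-eval []      pf = poly-resp (λ _ _ → ι-0) (poly-const 0ℚ)
    poly-eval (a ∷ p) pf = poly-+ (poly-const a) (poly-* pf (poly-eval p pf))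

    module Irreducible (galois : IsGaloisOverℚ (U {A = Carrier})) {α : Carrier} (root-α : Root α)
      (minimal : ∀ q n → ℚ[X].MonicOfDegree n q → IsRoot q α → k ℕ.≤ n) where

      -- f(α) = 0 forces the coefficients of f to be 0, by independence of the powers of α, and then
      -- f vanishes at every root. It is the isomorphism ℚ(α) ≅ ℚ(x) in elementary form.
      vanishes-at-roots : ∀ {f} → PolynomialOnRoots f → f α ≈ 0# → ∀ x → Root x → f x ≈ 0#
      vanishes-at-roots (q , f≈) fα≈0 x root = trans (f≈ x root) (horner-zero k x λ j j<k →
        trans (ι-cong (horner-independent minimal k q ℕ.≤-refl
          (trans (sym (f≈ α root-α)) fα≈0) j j<k)) ι-0)

      -- With constant term 0 the polynomial would be X p, and cancelling the invertible y would
      -- make p a monic polynomial of smaller degree vanishing at y. The goal is a negation, so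
      -- invertibility up to double negation is enough.
      constant-term-≢0 : ∀ {y a p n} → ¬ (y ≈ 0#) → ℚ[X].MonicOfDegree n (a ∷ p) →
        (∀ q m → ℚ[X].MonicOfDegree m q → IsRoot q y → n ℕ.≤ m) → IsRoot (a ∷ p) y → a ≢ 0ℚ
      constant-term-≢0 {n = zero}  y≉0 (() , _) min root ≡.refl
      constant-term-≢0 {y} {a} {p} {suc n} y≉0 (top , high) min root ≡.refl =
        nonzero⇒¬¬invertible y≉0 λ { (z , zy) →
          ℕ.1+n≰n (min p n (top , λ m n<m → high (suc m) (s≤s n<m)) (cancel z zy)) }
        where
        cancel : ∀ z → z * y ≈ 1# → IsRoot p y
        cancel z zy = begin
          P                    ≈⟨ *-identityˡ _ ⟨
          1# * P               ≈⟨ *-congʳ zy ⟨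
          z * y * P            ≈⟨ *-assoc _ _ _ ⟩
          z * (y * P)          ≈⟨ *-congˡ (trans (+-congʳ ι-0) (+-identityˡ _)) ⟨
          z * (ι 0ℚ + y * P)   ≈⟨ *-congˡ root ⟩
          z * 0#               ≈⟨ zeroʳ z ⟩
          0#                   ∎
          where
          open SetoidReasoning setoid
          P = K[X].eval (ιₚ p) y

      -- Let a + X p be the minimal polynomial of the value Y at α. As a is nonzero, -a⁻¹ p(Y)
      -- inverts Y at α. This is a polynomial expression, so by `vanishes-at-roots` the same
      -- coefficients give the inverse at every root.
      inverse-on-roots : ∀ q {j} → j ℕ.< k → q j ≢ 0ℚ →
        ∃[ u ] ∀ x → Root x → horner k (ι ∘ u) x * horner k (ι ∘ q) x ≈ 1#
      inverse-on-roots q {j} j<k qj≢0 with galois (horner k (ι ∘ q) α) _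
      ... | [] , record { monic = () , _ } , _
      ... | a ∷ p , mp , _ = proj₁ u-poly , λ x root → begin
          V x * Y x                    ≈⟨ *-congʳ (proj₂ u-poly x root) ⟨
          u x * Y x                    ≈⟨ +-identityʳ _ ⟨
          u x * Y x + 0#               ≈⟨ +-congˡ (-‿inverseˡ 1#) ⟨
          u x * Y x + (- 1# + 1#)      ≈⟨ +-assoc _ _ _ ⟨
          u x * Y x + - 1# + 1#        ≈⟨ +-congʳ (+-congˡ (trans (ι-neg 1ℚ) (-‿cong ι-1))) ⟨
          u x * Y x + ι (ℚ.- 1ℚ) + 1#
            ≈⟨ +-congʳ (vanishes-at-roots (poly-+ (poly-* u-poly (q , λ _ _ → refl))
                 (poly-const (ℚ.- 1ℚ))) vanishes x root) ⟩
          0# + 1#                      ≈⟨ +-identityˡ 1# ⟩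
          1#                           ∎
        where
        open SetoidReasoning setoid
        open IsMinimalPolynomial mp using (monic; isRoot)
        Y : Carrier → Carrier
        Y = horner k (ι ∘ q)
        a≢0 : a ≢ 0ℚ
        a≢0 = constant-term-≢0 {p = p} (λ Y≈0 → qj≢0 (horner-independent minimal k q ℕ.≤-refl Y≈0 j j<k))
          monic (IsMinimalPolynomial.minimal mp) isRoot
        b = proj₁ (*-inverseˡ-≢0 a≢0)
        u : Carrier → Carrier
        u x = ι (ℚ.- b) * K[X].eval (ιₚ p) (Y x)
        u-poly : PolynomialOnRoots u
        u-poly = poly-ι* (ℚ.- b) (poly-eval p (q , λ _ _ → refl))
        V : Carrier → Carrier
        V = horner k (ι ∘ proj₁ u-poly)
        P = K[X].eval (ιₚ p) (Y α)
        vanishes : u α * Y α + ι (ℚ.- 1ℚ) ≈ 0#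
        vanishes = begin
          ι (ℚ.- b) * P * Y α + ι (ℚ.- 1ℚ)
            ≈⟨ +-congˡ (ι-cong (≡.trans (≡.cong ℚ.-_ (≡.sym (proj₂ (*-inverseˡ-≢0 a≢0))))
                 (ℚ.neg-distribˡ-* b a))) ⟩
          ι (ℚ.- b) * P * Y α + ι (ℚ.- b ℚ.* a)
            ≈⟨ +-congˡ (ι-* _ _) ⟩
          ι (ℚ.- b) * P * Y α + ι (ℚ.- b) * ι a
            ≈⟨ solve 4 (λ b p y a → b :* p :* y :+ b :* a := b :* (a :+ y :* p)) refl _ P (Y α) (ι a) ⟩
          ι (ℚ.- b) * (ι a + Y α * P)   ≈⟨ *-congˡ isRoot ⟩
          ι (ℚ.- b) * 0#                ≈⟨ zeroʳ _ ⟩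
          0#                            ∎

-- Linear functionals, coordinates and the trace.

module PowerTraces {c ℓ₁ ℓ₂} (K : FieldExtensionOfℚ c ℓ₁ ℓ₂) where
  open FieldExtensionOfℚ K hiding (zero)
  open Extension K using (Basis; Tr)
  open MinimalPolynomials K
  open RingProperties ring
  open Horner commutativeRing
  open Exp semiring using (_^_)
  open Sum semiring
  open SemiringSolver commutativeSemiring using (solve; con; _:=_; _:+_; _:*_)

  record IsLinear (φ : Carrier → ℚ) : Set (c ⊔ ℓ₁) where
    field
      cong  : ∀ {x y} → x ≈ y → φ x ≡ φ y
      +-hom : ∀ x y → φ (x + y) ≡ φ x ℚ.+ φ y
      ι-hom : ∀ a x → φ (ι a * x) ≡ a ℚ.* φ x

    0-hom : φ 0# ≡ 0ℚ
    0-hom = ≡.trans (cong (sym (zeroʳ (ι 0ℚ)))) (≡.trans (ι-hom 0ℚ 0#) (ℚ.*-zeroˡ (φ 0#)))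

    sum-hom : ∀ {n} (v : Vector Carrier n) → φ (sum v) ≡ ℚ-Sum.sum (φ ∘ v)
    sum-hom {zero}  v = 0-hom
    sum-hom {suc n} v = ≡.trans (+-hom _ _) (≡.cong (φ (v zero) ℚ.+_) (sum-hom (v ∘ suc)))

    horner-hom : ∀ n g x y → φ (horner n g x * y) ≡
      ℚ-Sum.sum {n} (λ j → φ (g (toℕ j) * (x ^ (n ℕ.∸ suc (toℕ j)) * y)))
    horner-hom zero    g x y = ≡.trans (cong (zeroˡ y)) 0-hom
    horner-hom (suc n) g x y = ≡.trans (cong (trans (*-congʳ (horner-cons n g x))
        (trans (distribʳ y _ _) (+-congʳ (*-assoc _ _ _)))))
      (≡.trans (+-hom _ _) (≡.cong (φ (g 0 * (x ^ n * y)) ℚ.+_) (horner-hom n (g ∘ suc) x y)))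

    -- A stage of Horner's scheme is G 0 xʲ + ⋯ + G j, the convolution of G with the powers of x.
    -- Newton's identities for φ therefore amount to the values of φ on these stages.
    horner-conv : ∀ G x j → φ (horner (suc j) (ι ∘ G) x) ≡ ℚ-Seq.conv G (λ l → φ (x ^ l)) j
    horner-conv G x zero    = ≡.trans (cong (trans (+-congʳ (zeroʳ x)) (trans (+-identityˡ _)
      (sym (*-identityʳ _))))) (ι-hom (G 0) 1#)
    horner-conv G x (suc j) = ≡.trans (cong (horner-cons (suc j) (ι ∘ G) x))
      (≡.trans (+-hom _ _) (≡.cong₂ ℚ._+_ (ι-hom (G 0) (x ^ suc j)) (horner-conv (G ∘ suc) x j)))

  linear-∘* : ∀ {φ} → IsLinear φ → ∀ y → IsLinear (λ x → φ (y * x))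
  linear-∘* lin y = record
    { cong  = λ eq → cong (*-congˡ eq)
    ; +-hom = λ u v → ≡.trans (cong (distribˡ y u v)) (+-hom _ _)
    ; ι-hom = λ a x → ≡.trans (cong (solve 3 (λ y a x → y :* (a :* x) := a :* (y :* x)) refl y (ι a) x))
        (ι-hom a _)
    }
    where open IsLinear lin

  at : ∀ {a} {A : Set a} {n} → A → Fin n → A → Fin n → A
  at z zero    v zero    = v
  at z zero    v (suc i) = z
  at z (suc b) v zero    = z
  at z (suc b) v (suc i) = at z b v i

  at-≡ : ∀ {a} {A : Set a} {n} (z : A) (b : Fin n) v → at z b v b ≡ v
  at-≡ z zero    v = ≡.refl
  at-≡ z (suc b) v = at-≡ z b v

  sum-zero : ∀ {n} {v : Vector Carrier n} → (∀ i → v i ≈ 0#) → sum v ≈ 0#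
  sum-zero {n} eq = trans (sum-cong-≋ eq) (sum-replicate-zero n)

  sum-at : ∀ {a} {A : Set a} {n} (z : A) (b : Fin n) v (F : Fin n → A → Carrier) →
    (∀ i → F i z ≈ 0#) → sum (λ i → F i (at z b v i)) ≈ F b v
  sum-at z zero    v F F0 = trans (+-congˡ (sum-zero (F0 ∘ suc))) (+-identityʳ _)
  sum-at z (suc b) v F F0 = trans (+-cong (F0 zero) (sum-at z b v (F ∘ suc) (F0 ∘ suc))) (+-identityˡ _)

  ℚ-sum-const : ∀ n q → ℚ-Sum.sum {n} (λ _ → q) ≡ ℚ-Seq.nat n ℚ.* q
  ℚ-sum-const zero    q = ≡.sym (ℚ.*-zeroˡ q)
  ℚ-sum-const (suc n) q = ≡.trans (≡.cong₂ ℚ._+_ (≡.sym (ℚ.*-identityˡ q)) (ℚ-sum-const n q))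
    (≡.sym (ℚ.*-distribʳ-+ q 1ℚ (ℚ-Seq.nat n)))

  -- Covers both the given basis of K, indexed by `Fin d`, and the basis βᵃ ω_b, indexed by
  -- `Fin e × ℕ`. In the latter `Valid` keeps exponents below k, as coefficient sequences are
  -- infinite but only k entries are read.
  record Coordinates (I : Set) (Valid : I → Set) : Set (c ⊔ ℓ₁) where
    field
      comb      : (I → ℚ) → Carrier
      comb-+    : ∀ q r → comb (λ i → q i ℚ.+ r i) ≈ comb q + comb r
      comb-ι    : ∀ a q → comb (λ i → a ℚ.* q i) ≈ ι a * comb q
      free      : ∀ q → comb q ≈ 0# → ∀ i → Valid i → q i ≡ 0ℚ
      spans     : ∀ x → ∃[ q ] x ≈ comb q

    coordinate : Carrier → I → ℚ
    coordinate x = proj₁ (spans x)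

    unique : ∀ q r → comb q ≈ comb r → ∀ i → Valid i → q i ≡ r i
    unique q r eq i v = ℚG.x∙y⁻¹≈ε⇒x≈y (q i) (r i) (≡.trans (≡.cong (q i ℚ.+_) (ℚ-neg (r i)))
      (free (λ i → q i ℚ.+ ℚ.- 1ℚ ℚ.* r i) (begin
        comb (λ i → q i ℚ.+ ℚ.- 1ℚ ℚ.* r i)   ≈⟨ comb-+ q (λ i → ℚ.- 1ℚ ℚ.* r i) ⟩
        comb q + comb (λ i → ℚ.- 1ℚ ℚ.* r i)  ≈⟨ +-cong eq (comb-ι (ℚ.- 1ℚ) r) ⟩
        comb r + ι (ℚ.- 1ℚ) * comb r
          ≈⟨ +-congˡ (trans (*-congʳ (trans (ι-neg 1ℚ) (-‿cong ι-1))) (-1*x≈-x (comb r))) ⟩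
        comb r - comb r                       ≈⟨ -‿inverseʳ (comb r) ⟩
        0#                                    ∎) i v))
      where
      open SetoidReasoning setoid
      module ℚG = RingProperties (CommutativeRing.ring ℚ.+-*-commutativeRing)
      ℚ-neg : ∀ x → ℚ.- x ≡ ℚ.- 1ℚ ℚ.* x
      ℚ-neg x = ≡.sym (ℚG.-1*x≈-x x)

    coordinate-unique : ∀ {x} q → x ≈ comb q → ∀ i → Valid i → coordinate x i ≡ q i
    coordinate-unique {x} q x≈ = unique (coordinate x) q (trans (sym (proj₂ (spans x))) x≈)

    -- Coordinates are chosen element by element by `spans`, so linearity, and even compatibility
    -- with `≈`, rests on their uniqueness.
    coordinate-linear : ∀ i → Valid i → IsLinear (λ x → coordinate x i)
    coordinate-linear i v = record
      { cong  = λ {x} {y} x≈y → coordinate-unique (coordinate y) (trans x≈y (proj₂ (spans y))) i v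
      ; +-hom = λ x y → coordinate-unique (λ i → coordinate x i ℚ.+ coordinate y i)
          (trans (+-cong (proj₂ (spans x)) (proj₂ (spans y))) (sym (comb-+ _ _))) i v
      ; ι-hom = λ a x → coordinate-unique (λ i → a ℚ.* coordinate x i)
          (trans (*-congˡ (proj₂ (spans x))) (sym (comb-ι a _))) i v
      }

  module _ {d} (B : Basis d) where
    open Basis B

    basis-coordinates : Coordinates (Fin d) (λ _ → ⊤)
    basis-coordinates = record
      { comb   = λ q → sum (λ i → ι (q i) * e i)
      ; comb-+ = λ q r → trans (sum-cong-≋ {d} (λ i → trans (*-congʳ (ι-+ (q i) (r i))) (distribʳ _ _ _)))
          (∑-distrib-+ {d} _ _)
      ; comb-ι = λ a q → trans (sum-cong-≋ {d} (λ i → trans (*-congʳ (ι-* a (q i))) (*-assoc _ _ _)))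
          (sym (*-distribˡ-sum {d} (ι a) _))
      ; free   = λ q eq i _ → independent q eq i
      ; spans  = spanning
      }

    coord-linear : ∀ i → IsLinear (λ x → coord x i)
    coord-linear i = Coordinates.coordinate-linear basis-coordinates i _

    Tr-linear : IsLinear (Tr B)
    Tr-linear = record
      { cong  = λ x≈y → ℚ-Sum.sum-cong-≗ {d} (λ i → IsLinear.cong (coord-linear i) (*-congʳ x≈y))
      ; +-hom = λ x y → ≡.trans (ℚ-Sum.sum-cong-≗ {d} (λ i →
          ≡.trans (IsLinear.cong (coord-linear i) (distribʳ (e i) x y)) (IsLinear.+-hom (coord-linear i) _ _)))
          (ℚ-Sum.∑-distrib-+ {d} _ _)
      ; ι-hom = λ a x → ≡.trans (ℚ-Sum.sum-cong-≗ {d} (λ i →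
          ≡.trans (IsLinear.cong (coord-linear i) (*-assoc (ι a) x (e i))) (IsLinear.ι-hom (coord-linear i) a _)))
          (≡.sym (ℚ-Sum.*-distribˡ-sum {d} a _))
      }

    Tr-1 : Tr B 1# ≡ ℚ-Seq.nat d
    Tr-1 = ≡.trans (ℚ-Sum.sum-cong-≗ {d} (λ i → ≡.trans
        (Coordinates.coordinate-unique basis-coordinates (at 0ℚ i 1ℚ)
          (trans (*-congʳ (sym ι-1)) (sym (sum-at 0ℚ i 1ℚ (λ i q → ι q * e i)
            (λ i → trans (*-congʳ ι-0) (zeroˡ _))))) i _)
        (at-≡ 0ℚ i 1ℚ)))
      (≡.trans (ℚ-sum-const d 1ℚ) (ℚ.*-identityʳ _))

-- Bases over ℚ(β) and traces of the powers of a root.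

module RootTrace {c ℓ₁ ℓ₂} (K : FieldExtensionOfℚ c ℓ₁ ℓ₂)
  (k′ : ℕ) (G : ℕ → ℚ) (G₀≡1 : G 0 ≡ 1ℚ) where
  open FieldExtensionOfℚ K hiding (zero)
  open Extension K using (Basis; Tr)
  open MinimalPolynomials K
  open Roots k′ G G₀≡1
  open PowerTraces K
  open RingProperties ring
  open Horner commutativeRing
  open Exp semiring using (_^_)
  open Sum semiring
  open SemiringSolver commutativeSemiring using (solve; con; _:=_; _:+_; _:*_)

  module AtRoot {β : Carrier} (root : Root β)
    (inverse : ∀ q {j} → j ℕ.< k → q j ≢ 0ℚ →
      ∃[ u ] horner k (ι ∘ u) β * horner k (ι ∘ q) β ≈ 1#) where

    ev : (ℕ → ℚ) → Carrier
    ev q = horner k (ι ∘ q) β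

    ev-+ : ∀ q r → ev (λ j → q j ℚ.+ r j) ≈ ev q + ev r
    ev-+ q r = trans (horner-cong k β (λ j _ → ι-+ _ _)) (horner-+ k _ _ β)

    ev-ι : ∀ a q → ev (λ j → a ℚ.* q j) ≈ ι a * ev q
    ev-ι a q = trans (horner-cong k β (λ j _ → ι-* _ _)) (horner-scale k _ _ β)

    ev-0 : ∀ {q} → (∀ j → j ℕ.< k → q j ≡ 0ℚ) → ev q ≈ 0#
    ev-0 q≡0 = horner-zero k β (λ j j<k → trans (ι-cong (q≡0 j j<k)) ι-0)

    combination : ∀ {e} → Vector Carrier e → (Fin e × ℕ → ℚ) → Carrier
    combination ω Q = sum (λ b → ev (λ j → Q (b , j)) * ω b)

    InSpan : ∀ {e} → Vector Carrier e → Carrier → Set ℓ₁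
    InSpan ω x = ∃[ Q ] x ≈ combination ω Q

    Free : ∀ {e} → Vector Carrier e → Set ℓ₁
    Free ω = ∀ Q → combination ω Q ≈ 0# → ∀ b j → j ℕ.< k → Q (b , j) ≡ 0ℚ

    combination-+ : ∀ {e} (ω : Vector Carrier e) Q R →
      combination ω (λ i → Q i ℚ.+ R i) ≈ combination ω Q + combination ω R
    combination-+ {e} ω Q R = trans
      (sum-cong-≋ {e} (λ b → trans (*-congʳ (ev-+ (λ j → Q (b , j)) (λ j → R (b , j)))) (distribʳ _ _ _)))
      (∑-distrib-+ {e} _ _)

    combination-ι : ∀ {e} (ω : Vector Carrier e) a Q →
      combination ω (λ i → a ℚ.* Q i) ≈ ι a * combination ω Q
    combination-ι {e} ω a Q = trans
      (sum-cong-≋ {e} (λ b → trans (*-congʳ (ev-ι a (λ j → Q (b , j)))) (*-assoc _ _ _)))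
      (sym (*-distribˡ-sum {e} (ι a) _))

    combination-β : ∀ {e} (ω : Vector Carrier e) Q →
      β * combination ω Q ≈ combination ω (λ (b , j) → mulX (λ j → Q (b , j)) j)
    combination-β {e} ω Q = trans (*-distribˡ-sum {e} β _) (sum-cong-≋ {e} (λ b →
      trans (sym (*-assoc _ _ _)) (*-congʳ (horner-mulX root (λ j → Q (b , j))))))

    combination-at : ∀ {e} (ω : Vector Carrier e) b q →
      combination ω (λ (b′ , j) → at (λ _ → 0ℚ) b q b′ j) ≈ ev q * ω b
    combination-at ω b q = sum-at (λ _ → 0ℚ) b q (λ b q → ev q * ω b)
      (λ b → trans (*-congʳ (ev-0 (λ _ _ → ≡.refl))) (zeroˡ _))

    span-+ : ∀ {e} {ω : Vector Carrier e} {x y} → InSpan ω x → InSpan ω y → InSpan ω (x + y)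
    span-+ {ω = ω} (Q , x≈) (R , y≈) =
      (λ i → Q i ℚ.+ R i) , trans (+-cong x≈ y≈) (sym (combination-+ ω Q R))

    span-ι : ∀ {e} {ω : Vector Carrier e} a {x} → InSpan ω x → InSpan ω (ι a * x)
    span-ι {ω = ω} a (Q , x≈) = (λ i → a ℚ.* Q i) , trans (*-congˡ x≈) (sym (combination-ι ω a Q))

    span-β : ∀ {e} {ω : Vector Carrier e} {x} → InSpan ω x → InSpan ω (β * x)
    span-β {ω = ω} (Q , x≈) = _ , trans (*-congˡ x≈) (combination-β ω Q)

    span-resp : ∀ {e} {ω : Vector Carrier e} {x y} → x ≈ y → InSpan ω x → InSpan ω y
    span-resp x≈y (Q , x≈) = Q , trans (sym x≈y) x≈

    span-0 : ∀ {e} {ω : Vector Carrier e} → InSpan ω 0#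
    span-0 {e} = (λ _ → 0ℚ) , sym (sum-zero {e}
      (λ b → trans (*-congʳ (ev-0 (λ _ _ → ≡.refl))) (zeroˡ _)))

    span-sum : ∀ {e} {ω : Vector Carrier e} {n} {v : Vector Carrier n} →
      (∀ i → InSpan ω (v i)) → InSpan ω (sum v)
    span-sum {n = zero}  v∈ = span-0
    span-sum {n = suc n} v∈ = span-+ (v∈ zero) (span-sum (v∈ ∘ suc))

    span-horner : ∀ {e} {ω : Vector Carrier e} n q {x} → InSpan ω x →
      InSpan ω (horner n (ι ∘ q) β * x)
    span-horner zero    q x∈ = span-resp (sym (zeroˡ _)) span-0
    span-horner (suc n) q {x} x∈ = span-resp
      (solve 4 (λ b h x a → b :* (h :* x) :+ a :* x := (b :* h :+ a) :* x) refl β _ x (ι (q n)))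
      (span-+ (span-β (span-horner n q x∈)) (span-ι (q n) x∈))

    span-cons : ∀ {e} {ω : Vector Carrier e} v {x} → InSpan ω x → InSpan (v Vector.∷ ω) x
    span-cons v (Q , x≈) = (λ { (zero , _) → 0ℚ ; (suc b , j) → Q (b , j) }) ,
      trans x≈ (sym (trans (+-congʳ (trans (*-congʳ (ev-0 (λ _ _ → ≡.refl))) (zeroˡ v))) (+-identityˡ _)))

    one : ∃[ q ] ev q ≈ 1#
    one with q , eq ← poly-const 1ℚ = q , trans (sym (eq β root)) ι-1

    span-head : ∀ {e} (ω : Vector Carrier e) v → InSpan (v Vector.∷ ω) v
    span-head ω v = (λ (b , j) → at (λ _ → 0ℚ) zero (proj₁ one) b j) ,
      sym (trans (combination-at (v Vector.∷ ω) zero (proj₁ one))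
      (trans (*-congʳ (proj₂ one)) (*-identityˡ v)))

    -- If the coefficient of v in a relation had a nonzero entry, it would be invertible in ℚ(β) and
    -- v would lie in the span of ω. Equality in ℚ is decidable, so the entries are 0, and freeness
    -- of ω settles the rest.
    free-cons : ∀ {e} {ω : Vector Carrier e} {v} → Free ω → ¬ InSpan ω v → Free (v Vector.∷ ω)
    free-cons {ω = ω} {v} free v∉ Q eq = λ { zero → first ; (suc b) → free Q′ rest≈0 b }
      where
      q : ℕ → ℚ
      q j = Q (zero , j)
      Q′ : _ → ℚ
      Q′ (b , j) = Q (suc b , j)
      first : ∀ j → j ℕ.< k → q j ≡ 0ℚ
      first j j<k = decidable-stable (q j ℚ.≟ 0ℚ) λ qj≢0 → v∉ (v∈ (inverse q j<k qj≢0))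
        where
        v∈ : ∃[ u ] ev u * ev q ≈ 1# → InSpan ω v
        v∈ (u , uq) = span-resp (begin
          ev u * (ι (ℚ.- 1ℚ) * combination ω Q′)
            ≈⟨ *-congˡ (trans (*-congʳ (trans (ι-neg 1ℚ) (-‿cong ι-1))) (-1*x≈-x _)) ⟩
          ev u * - combination ω Q′   ≈⟨ *-congˡ (+-inverseˡ-unique _ _ eq) ⟨
          ev u * (ev q * v)           ≈⟨ *-assoc _ _ _ ⟨
          ev u * ev q * v             ≈⟨ *-congʳ uq ⟩
          1# * v                      ≈⟨ *-identityˡ v ⟩
          v                           ∎)
          (span-horner k u (span-ι (ℚ.- 1ℚ) (Q′ , refl)))
          where open SetoidReasoning setoid
      rest≈0 : combination ω Q′ ≈ 0#
      rest≈0 = trans (sym (trans (+-congʳ (trans (*-congʳ (ev-0 first)) (zeroˡ v))) (+-identityˡ _))) eq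

    -- Membership in a span is not decided; it is enough to know it up to double negation, since
    -- only equalities in ℕ and ℚ are drawn from the basis.
    ¬¬free-spanning : ∀ n (v : Vector Carrier n) →
      ¬ ¬ (∃[ e ] Σ (Vector Carrier e) λ ω → Free ω × (∀ i → InSpan ω (v i)))
    ¬¬free-spanning zero    v none = none (0 , (λ ()) , (λ _ _ ()) , λ ())
    ¬¬free-spanning (suc n) v none = ¬¬free-spanning n (v ∘ suc) λ { (e , ω , free , v∈) →
      let ¬head∈ : ¬ InSpan ω (v zero)
          ¬head∈ head∈ = none (e , ω , free , λ { zero → head∈ ; (suc i) → v∈ i })
      in none (suc e , v zero Vector.∷ ω , free-cons free ¬head∈ ,
           λ { zero → span-head ω (v zero) ; (suc i) → span-cons (v zero) (v∈ i) }) }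

    -- For j < k these are the coefficients of m(X)/(X - β), leading one first; γ k is the remainder
    -- m(β) = 0.
    γ : ℕ → Carrier
    γ j = horner (suc j) (ι ∘ G) β

    γ0≈1 : γ 0 ≈ 1#
    γ0≈1 = trans (+-cong (zeroʳ β) (trans (ι-cong G₀≡1) ι-1)) (+-identityˡ 1#)

    module _ {d} (B : Basis d) {e′} (ω : Vector Carrier e′) (ω-free : Free ω)
      (ω-spans : ∀ x → InSpan ω x) where
      open Basis B
      private
        coordinates : Coordinates (Fin e′ × ℕ) (λ (b , j) → j ℕ.< k)
        coordinates = record
          { comb   = combination ω
          ; comb-+ = combination-+ ω
          ; comb-ι = combination-ι ω
          ; free   = λ Q eq (b , j) → ω-free Q eq b j
          ; spans  = ω-spans
          }
        open Coordinates coordinates using (coordinate; coordinate-unique; coordinate-linear)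

      -- In the order of `horner`, index j belongs to the basis element β^(k-1-j) ω_b; thus `Λ b 0`
      -- reads off the coefficient of the top power of β.
      Λ : Fin e′ → ℕ → Carrier → ℚ
      Λ b j x = coordinate x (b , j)

      Λ-linear : ∀ b {j} → j ℕ.< k → IsLinear (Λ b j)
      Λ-linear b {j} = coordinate-linear (b , j)

      -- `mulX` gives coordinate j of β x as coordinate j + 1 of x minus G (j + 1) times coordinate
      -- 0; this is solved for coordinate j + 1.
      Λ-suc : ∀ b {j} x → suc j ℕ.< k → Λ b (suc j) x ≡ Λ b j (β * x) ℚ.+ G (suc j) ℚ.* Λ b 0 x
      Λ-suc b {j} x j<k = ≡.sym (≡.trans
        (≡.cong (ℚ._+ G (suc j) ℚ.* Λ b 0 x) (≡.trans
          (coordinate-unique _ (trans (*-congˡ (proj₂ (ω-spans x))) (combination-β ω (coordinate x)))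
            (b , j) (ℕ.<⇒≤ j<k))
          (≡.cong (ℚ._+ ℚ.- Λ b 0 x ℚ.* G (suc j)) (ℚ-Seq.trunc-< k (λ j → Λ b j x) j<k))))
        (identity (Λ b (suc j) x) (Λ b 0 x) (G (suc j))))
        where
        identity : ∀ l a g → l ℚ.+ ℚ.- a ℚ.* g ℚ.+ g ℚ.* a ≡ l
        identity l a g = ≡.trans (ℚ.+-assoc l _ _) (≡.trans (≡.cong (l ℚ.+_)
          (≡.trans (≡.cong₂ ℚ._+_ (≡.sym (ℚ.neg-distribˡ-* a g)) (ℚ.*-comm g a)) (ℚ.+-inverseˡ (a ℚ.* g))))
          (ℚ.+-identityʳ l))

      -- The γ j form, up to order, the basis dual to 1, β, …, βᵏ⁻¹ for the form (x , y) ↦ Λ b 0 (x y).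
      Λ-γ : ∀ b {j} x → j ℕ.< k → Λ b j x ≡ Λ b 0 (γ j * x)
      Λ-γ b {zero}  x j<k = IsLinear.cong (Λ-linear b j<k) (sym (trans (*-congʳ γ0≈1) (*-identityˡ x)))
      Λ-γ b {suc j} x j<k = begin
        Λ b (suc j) x                                        ≡⟨ Λ-suc b x j<k ⟩
        Λ b j (β * x) ℚ.+ G (suc j) ℚ.* Λ b 0 x
          ≡⟨ ≡.cong₂ ℚ._+_ (Λ-γ b (β * x) (ℕ.<⇒≤ j<k)) (≡.sym (ι-hom _ x)) ⟩
        Λ b 0 (γ j * (β * x)) ℚ.+ Λ b 0 (ι (G (suc j)) * x)  ≡⟨ +-hom _ _ ⟨
        Λ b 0 (γ j * (β * x) + ι (G (suc j)) * x)
          ≡⟨ cong (solve 4 (λ g b x c → g :* (b :* x) :+ c :* x := (b :* g :+ c) :* x) refl (γ j) β x _) ⟩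
        Λ b 0 (γ (suc j) * x) ∎
        where
        open ≡.≡-Reasoning
        open IsLinear (Λ-linear b {0} (s≤s z≤n))

      linear-combination : ∀ {φ} → IsLinear φ → ∀ Q → φ (combination ω Q) ≡
        ℚ-Sum.sum {e′} (λ b → ℚ-Sum.sum {k} (λ j → Q (b , toℕ j) ℚ.* φ (β ^ (k ℕ.∸ suc (toℕ j)) * ω b)))
      linear-combination φ-lin Q = ≡.trans (sum-hom {e′} _) (ℚ-Sum.sum-cong-≗ {e′} (λ b →
        ≡.trans (horner-hom k _ β (ω b)) (ℚ-Sum.sum-cong-≗ {k} (λ j →
          ι-hom (Q (b , toℕ j)) (β ^ (k ℕ.∸ suc (toℕ j)) * ω b)))))
        where open IsLinear φ-lin

      -- Each e i is expanded in the basis βᵃ ω_b and the sums are exchanged; the sum over i then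
      -- reassembles y times a basis element. This is tr(PQ) = tr(QP) for P and Q rectangular, so
      -- the two bases may a priori differ in size.
      Tr-change-of-basis : ∀ y → Tr B y ≡ ℚ-Sum.sum {e′} (λ b → ℚ-Sum.sum {k} (λ j →
        Λ b (toℕ j) (y * (β ^ (k ℕ.∸ suc (toℕ j)) * ω b))))
      Tr-change-of-basis y = begin
        ℚ-Sum.sum {d} (λ i → coord (y * e i) i)
          ≡⟨ ℚ-Sum.sum-cong-≗ {d} (λ i → ≡.trans
               (IsLinear.cong (coord-linear B i) (*-congˡ (proj₂ (ω-spans (e i)))))
               (linear-combination (linear-∘* (coord-linear B i) y) (coordinate (e i)))) ⟩
        ℚ-Sum.sum {d} (λ i → ℚ-Sum.sum {e′} (λ b → ℚ-Sum.sum {k} (λ j →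
          Λ b (toℕ j) (e i) ℚ.* coord (z b j) i)))
          ≡⟨ ℚ-Sum.∑-comm {d} {e′} _ ⟩
        ℚ-Sum.sum {e′} (λ b → ℚ-Sum.sum {d} (λ i → ℚ-Sum.sum {k} (λ j →
          Λ b (toℕ j) (e i) ℚ.* coord (z b j) i)))
          ≡⟨ ℚ-Sum.sum-cong-≗ {e′} (λ b → ≡.trans
               (ℚ-Sum.∑-comm {d} {k} (λ i j → Λ b (toℕ j) (e i) ℚ.* coord (z b j) i))
               (ℚ-Sum.sum-cong-≗ {k} (λ j → collapse b j))) ⟩
        ℚ-Sum.sum {e′} (λ b → ℚ-Sum.sum {k} (λ j → Λ b (toℕ j) (z b j))) ∎
        where
        open ≡.≡-Reasoning
        z : Fin e′ → Fin k → Carrier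
        z b j = y * (β ^ (k ℕ.∸ suc (toℕ j)) * ω b)
        collapse : ∀ b j → ℚ-Sum.sum {d} (λ i → Λ b (toℕ j) (e i) ℚ.* coord (z b j) i) ≡ Λ b (toℕ j) (z b j)
        collapse b j = ≡.sym (≡.trans (cong (proj₂ (spanning (z b j)))) (≡.trans (sum-hom {d} _)
          (ℚ-Sum.sum-cong-≗ {d} (λ i → ≡.trans (ι-hom _ (e i)) (ℚ.*-comm _ (Λ b (toℕ j) (e i)))))))
          where open IsLinear (Λ-linear b (toℕ<n j))

      -- By `Λ-γ` the block of ω_b becomes Λ b 0 applied to γ i (∑ γ j β^(k-1-j)) ω_b, and the sum
      -- in the middle is m′(β). A second use of `Λ-γ` turns this into Λ b i (m′(β) ω_b), a
      -- coefficient of m′. It is the same for each of the e′ blocks.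
      Tr-γ : ∀ {i} → i ℕ.< k → Tr B (γ i) ≡ ℚ-Seq.nat e′ ℚ.* (ℚ-Seq.nat (k ℕ.∸ i) ℚ.* G i)
      Tr-γ {i} i<k = ≡.trans (Tr-change-of-basis (γ i))
        (≡.trans (ℚ-Sum.sum-cong-≗ {e′} block) (ℚ-sum-const e′ _))
        where
        derivative : horner k γ β ≈ ev (λ l → ℚ-Seq.nat (k ℕ.∸ l) ℚ.* G l)
        derivative = trans (horner-horner k (ι ∘ G) β)
          (horner-cong k β (λ l _ → sym (trans (ι-* _ _) (*-congʳ (ι-nat (k ℕ.∸ l))))))
        block : ∀ b → ℚ-Sum.sum {k} (λ j → Λ b (toℕ j) (γ i * (β ^ (k ℕ.∸ suc (toℕ j)) * ω b))) ≡
          ℚ-Seq.nat (k ℕ.∸ i) ℚ.* G i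
        block b = begin
          ℚ-Sum.sum {k} (λ j → Λ b (toℕ j) (γ i * (β ^ (k ℕ.∸ suc (toℕ j)) * ω b)))
            ≡⟨ ℚ-Sum.sum-cong-≗ {k} (λ j → ≡.trans (Λ-γ b (γ i * (β ^ (k ℕ.∸ suc (toℕ j)) * ω b)) (toℕ<n j))
                 (cong (solve 3 (λ g h p → g :* (h :* p) := h :* (g :* p)) refl
                   (γ (toℕ j)) (γ i) (β ^ (k ℕ.∸ suc (toℕ j)) * ω b)))) ⟩
          ℚ-Sum.sum {k} (λ j → Λ b 0 (γ i * (γ (toℕ j) * (β ^ (k ℕ.∸ suc (toℕ j)) * ω b))))
            ≡⟨ IsLinear.horner-hom (linear-∘* (Λ-linear b (s≤s z≤n)) (γ i)) k γ β (ω b) ⟨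
          Λ b 0 (γ i * (horner k γ β * ω b))      ≡⟨ Λ-γ b _ i<k ⟨
          Λ b i (horner k γ β * ω b)
            ≡⟨ coordinate-unique _ (trans (*-congʳ derivative) (sym (combination-at ω b _))) (b , i) i<k ⟩
          at (λ _ → 0ℚ) b (λ l → ℚ-Seq.nat (k ℕ.∸ l) ℚ.* G l) b i
            ≡⟨ ≡.cong (λ f → f i) (at-≡ (λ _ → 0ℚ) b _) ⟩
          ℚ-Seq.nat (k ℕ.∸ i) ℚ.* G i             ∎
          where
          open ≡.≡-Reasoning
          open IsLinear (Λ-linear b {0} (s≤s z≤n)) using (cong)

    γ-high : (∀ j → k ℕ.< j → G j ≡ 0ℚ) → ∀ j → γ (k ℕ.+ j) ≈ 0#
    γ-high G-high zero    = trans (reflexive (≡.cong γ (ℕ.+-identityʳ k))) root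
    γ-high G-high (suc j) = trans (reflexive (≡.cong γ (ℕ.+-suc k j))) (trans
      (+-cong (trans (*-congˡ (γ-high G-high j)) (zeroʳ β))
        (trans (ι-cong (G-high (suc (k ℕ.+ j)) (s≤s (ℕ.m≤m+n k j)))) ι-0))
      (+-identityˡ 0#))

    module _ {d} (B : Basis d) where
      open Basis B

      -- Since γ 0 = 1, the formula at i = 0 reads Tr 1 = e′ k, while Tr 1 = d in the given basis:
      -- the degree formula is a trace identity.
      ¬¬Tr-γ : ¬ ¬ (∃[ e′ ] e′ ℕ.* k ≡ d ×
        (∀ {i} → i ℕ.< k → Tr B (γ i) ≡ ℚ-Seq.nat e′ ℚ.* (ℚ-Seq.nat (k ℕ.∸ i) ℚ.* G i)))
      ¬¬Tr-γ none = ¬¬free-spanning d e λ { (e′ , ω , free , e∈) →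
        let traces : ∀ {i} → i ℕ.< k → Tr B (γ i) ≡ ℚ-Seq.nat e′ ℚ.* (ℚ-Seq.nat (k ℕ.∸ i) ℚ.* G i)
            traces = Tr-γ B ω free λ x → span-resp (sym (proj₂ (spanning x)))
              (span-sum (λ i → span-ι (coord x i) (e∈ i)))
            degree : ℚ-Seq.nat (e′ ℕ.* k) ≡ ℚ-Seq.nat d
            degree = begin
              ℚ-Seq.nat (e′ ℕ.* k)                        ≡⟨ nat-* e′ k ⟩
              ℚ-Seq.nat e′ ℚ.* ℚ-Seq.nat k                ≡⟨ ≡.cong (ℚ-Seq.nat e′ ℚ.*_) (ℚ.*-identityʳ _) ⟨
              ℚ-Seq.nat e′ ℚ.* (ℚ-Seq.nat k ℚ.* 1ℚ)
                ≡⟨ ≡.cong (λ g → ℚ-Seq.nat e′ ℚ.* (ℚ-Seq.nat k ℚ.* g)) G₀≡1 ⟨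
              ℚ-Seq.nat e′ ℚ.* (ℚ-Seq.nat k ℚ.* G 0)      ≡⟨ traces (s≤s z≤n) ⟨
              Tr B (γ 0)                                  ≡⟨ IsLinear.cong (Tr-linear B) γ0≈1 ⟩
              Tr B 1#                                     ≡⟨ Tr-1 B ⟩
              ℚ-Seq.nat d                                 ∎
        in none (e′ , nat-injective degree , traces) }
        where open ≡.≡-Reasoning

      -- Equality in ℕ is decidable, so the double negation can be removed once e′, which exists
      -- only under it, is replaced by the explicit quotient `d / k`.
      degree-divides : (d ℕ./ k) ℕ.* k ≡ d
      degree-divides = decidable-stable ((d ℕ./ k) ℕ.* k ℕ.≟ d) λ ≢ → ¬¬Tr-γ λ { (e′ , e′k≡d , _) →
        ≢ (≡.trans (≡.cong (ℕ._* k) (quotient e′ e′k≡d)) e′k≡d) }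
        where
        quotient : ∀ e′ → e′ ℕ.* k ≡ d → d ℕ./ k ≡ e′
        quotient e′ ≡.refl = ℕ.m*n/n≡m e′ k

      Tr-power-recurrence : (∀ j → k ℕ.< j → G j ≡ 0ℚ) → ∀ j →
        ℚ-Seq.conv G (λ l → Tr B (β ^ l)) j ≡ ℚ-Seq.nat (d ℕ./ k) ℚ.* (ℚ-Seq.nat (k ℕ.∸ j) ℚ.* G j)
      Tr-power-recurrence G-high j = ≡.trans (≡.sym (IsLinear.horner-conv (Tr-linear B) G β j))
        (decidable-stable (Tr B (γ j) ℚ.≟ _) λ ≢ → ¬¬Tr-γ λ { (e′ , e′k≡d , traces) → ≢ (begin
          Tr B (γ j)                                            ≡⟨ all e′ traces (ℕ.<-≤-connex j k) ⟩
          ℚ-Seq.nat e′ ℚ.* (ℚ-Seq.nat (k ℕ.∸ j) ℚ.* G j)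
            ≡⟨ ≡.cong (λ m → ℚ-Seq.nat m ℚ.* (ℚ-Seq.nat (k ℕ.∸ j) ℚ.* G j))
                 (≡.trans (≡.sym (ℕ.m*n/n≡m e′ k)) (≡.cong (ℕ._/ k) e′k≡d)) ⟩
          ℚ-Seq.nat (d ℕ./ k) ℚ.* (ℚ-Seq.nat (k ℕ.∸ j) ℚ.* G j) ∎) })
        where
        open ≡.≡-Reasoning
        all : ∀ e′ → (∀ {i} → i ℕ.< k → Tr B (γ i) ≡ ℚ-Seq.nat e′ ℚ.* (ℚ-Seq.nat (k ℕ.∸ i) ℚ.* G i)) →
          j ℕ.< k ⊎ k ℕ.≤ j → Tr B (γ j) ≡ ℚ-Seq.nat e′ ℚ.* (ℚ-Seq.nat (k ℕ.∸ j) ℚ.* G j)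
        all e′ traces (inj₁ j<k) = traces j<k
        -- From degree k on both sides vanish: γ j because m(β) = 0, the right side because `k ∸ j`
        -- is 0.
        all e′ traces (inj₂ k≤j) = ≡.trans
          (≡.trans (IsLinear.cong (Tr-linear B) (trans (reflexive (≡.cong γ (≡.sym (ℕ.m+[n∸m]≡n k≤j))))
            (γ-high G-high (j ℕ.∸ k)))) (IsLinear.0-hom (Tr-linear B)))
          (≡.sym (≡.trans (≡.cong (λ m → ℚ-Seq.nat e′ ℚ.* (ℚ-Seq.nat m ℚ.* G j)) (ℕ.m≤n⇒m∸n≡0 k≤j))
            (≡.trans (≡.cong (ℚ-Seq.nat e′ ℚ.*_) (ℚ.*-zeroˡ (G j))) (ℚ.*-zeroʳ (ℚ-Seq.nat e′)))))

-- From the recurrence over ℚ to integral coefficients.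

conv-sum : ∀ {n} (G : ℕ → ℚ) (a : Fin n → ℚ) (T : Fin n → ℕ → ℚ) j →
  ℚ-Seq.conv G (λ l → ℚ-Sum.sum (λ i → a i ℚ.* T i l)) j ≡
  ℚ-Sum.sum (λ i → a i ℚ.* ℚ-Seq.conv G (T i) j)
conv-sum {n} G a T zero    = scale-sum (G 0) (λ i → T i 0)
  where
  scale-sum : ∀ g (t : Fin n → ℚ) → g ℚ.* ℚ-Sum.sum (λ i → a i ℚ.* t i) ≡ ℚ-Sum.sum (λ i → a i ℚ.* (g ℚ.* t i))
  scale-sum g t = ≡.trans (ℚ-Sum.*-distribˡ-sum {n} g _) (ℚ-Sum.sum-cong-≗ {n} λ i → swap g (a i) (t i))
    where
    open SemiringSolver (CommutativeRing.commutativeSemiring ℚ.+-*-commutativeRing)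
    swap : ∀ g a t → g ℚ.* (a ℚ.* t) ≡ a ℚ.* (g ℚ.* t)
    swap = solve 3 (λ g a t → g :* (a :* t) := a :* (g :* t)) ≡.refl
conv-sum {n} G a T (suc j) = begin
  G 0 ℚ.* ℚ-Sum.sum (λ i → a i ℚ.* T i (suc j)) ℚ.+ ℚ-Seq.conv (G ∘ suc) (λ l → ℚ-Sum.sum (λ i → a i ℚ.* T i l)) j
    -- The case of degree 0, applied to constant sequences, is the scaling rule for the head term.
    ≡⟨ ≡.cong₂ ℚ._+_ (conv-sum G a (λ i _ → T i (suc j)) 0) (conv-sum (G ∘ suc) a T j) ⟩
  ℚ-Sum.sum (λ i → a i ℚ.* (G 0 ℚ.* T i (suc j))) ℚ.+ ℚ-Sum.sum (λ i → a i ℚ.* ℚ-Seq.conv (G ∘ suc) (T i) j)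
    ≡⟨ ℚ-Sum.∑-distrib-+ {n} _ _ ⟨
  ℚ-Sum.sum (λ i → a i ℚ.* (G 0 ℚ.* T i (suc j)) ℚ.+ a i ℚ.* ℚ-Seq.conv (G ∘ suc) (T i) j)
    ≡⟨ ℚ-Sum.sum-cong-≗ {n} (λ i → ≡.sym (ℚ.*-distribˡ-+ (a i) _ _)) ⟩
  ℚ-Sum.sum (λ i → a i ℚ.* ℚ-Seq.conv G (T i) (suc j)) ∎
  where open ≡.≡-Reasoning

-- Here G is ∏ (1 - αᵢ X) and S j is n e times the j-th power sum of the k numbers αᵢ.
integral-coefficients : ∀ (n : ℤ) (e k L N : ℕ) (G S : ℕ → ℚ) →
  n ≢ 0ℤ → e ≢ 0 → ∣ n ∣ ℕ.* (e ℕ.* k) ℕ.< 2 ℕ.^ N → N ℕ.* k ℕ.≤ L →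
  G 0 ≡ 1ℚ → (∀ j → k ℕ.< j → G j ≡ 0ℚ) →
  (∀ j → ℚ-Seq.conv G S j ≡ fromℤ n ℚ.* (ℚ-Seq.nat e ℚ.* (ℚ-Seq.nat (k ℕ.∸ j) ℚ.* G j))) →
  (∀ j → 1 ℕ.≤ j → j ℕ.≤ L → IsInteger (S j)) → ∀ j → IsInteger (G j)
integral-coefficients n e k L N G S n≢0 e≢0 nek<2^N Nk≤L G₀≡1 G-high recurrence S-int
  with D , D≢0 , int ← common-denominator G (suc k) = λ j → divide j (leading-divides n′ k L N s n′≢0 ≡.refl
    (≡.subst (ℕ._< 2 ℕ.^ N) (≡.sym n′k) nek<2^N) Nk≤L D {{D≢0}} g g₀≡D g-high eqn j)
  where
  open ≡.≡-Reasoning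
  open SemiringSolver (CommutativeRing.commutativeSemiring ℚ.+-*-commutativeRing) using (solve; _:=_; _:+_; _:*_)
  n′ : ℤ
  n′ = n ℤ.* + e
  n′≢0 : n′ ≢ 0ℤ
  n′≢0 eq with ℤ.i*j≡0⇒i≡0∨j≡0 n eq
  ... | inj₁ n≡0 = n≢0 n≡0
  ... | inj₂ e≡0 = e≢0 (ℤ.+-injective e≡0)
  n′k : ∣ n′ ∣ ℕ.* k ≡ ∣ n ∣ ℕ.* (e ℕ.* k)
  n′k = ≡.trans (≡.cong (ℕ._* k) (ℤ.abs-* n (+ e))) (ℕ.*-assoc ∣ n ∣ e k)
  S₀ : S 0 ≡ fromℤ (n′ ℤ.* + k)
  S₀ = begin
    S 0                                                  ≡⟨ ℚ.*-identityˡ (S 0) ⟨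
    1ℚ ℚ.* S 0                                           ≡⟨ ≡.cong (ℚ._* S 0) G₀≡1 ⟨
    G 0 ℚ.* S 0                                          ≡⟨ recurrence 0 ⟩
    fromℤ n ℚ.* (ℚ-Seq.nat e ℚ.* (ℚ-Seq.nat k ℚ.* G 0))
      ≡⟨ ≡.cong (λ x → fromℤ n ℚ.* (ℚ-Seq.nat e ℚ.* x))
           (≡.trans (≡.cong (ℚ-Seq.nat k ℚ.*_) G₀≡1) (ℚ.*-identityʳ _)) ⟩
    fromℤ n ℚ.* (ℚ-Seq.nat e ℚ.* ℚ-Seq.nat k)            ≡⟨ ℚ.*-assoc (fromℤ n) (ℚ-Seq.nat e) (ℚ-Seq.nat k) ⟨
    fromℤ n ℚ.* ℚ-Seq.nat e ℚ.* ℚ-Seq.nat k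
      ≡⟨ ≡.cong₂ (λ x y → fromℤ n ℚ.* x ℚ.* y) (nat≡fromℤ e) (nat≡fromℤ k) ⟩
    fromℤ n ℚ.* fromℤ (+ e) ℚ.* fromℤ (+ k)              ≡⟨ ≡.cong (ℚ._* fromℤ (+ k)) (fromℤ-* n (+ e)) ⟨
    fromℤ n′ ℚ.* fromℤ (+ k)                             ≡⟨ fromℤ-* n′ (+ k) ⟨
    fromℤ (n′ ℤ.* + k)                                   ∎

  -- Integrality is assumed only for 1 ≤ j ≤ L. At 0 the recurrence itself yields n e k; beyond L
  -- the value 0 is a placeholder, as the equation is wanted only up to L.
  sInt : ∀ j → Dec (j ℕ.≤ L) → ℤ
  sInt zero    _         = n′ ℤ.* + k
  sInt (suc j) (yes j≤L) = proj₁ (S-int (suc j) (s≤s z≤n) j≤L)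
  sInt (suc j) (no _)    = 0ℤ
  s : ℕ → ℤ
  s j = sInt j (j ℕ.≤? L)
  S≡s : ∀ j → j ℕ.≤ L → S j ≡ fromℤ (s j)
  S≡s j j≤L = go j j≤L (j ℕ.≤? L)
    where
    go : ∀ j → j ℕ.≤ L → (dec : Dec (j ℕ.≤ L)) → S j ≡ fromℤ (sInt j dec)
    go zero    _   _         = S₀
    go (suc j) j≤L (yes p)   = proj₂ (S-int (suc j) (s≤s z≤n) p)
    go (suc j) j≤L (no j≰L)  = contradiction j≤L j≰L
  DG-integer : ∀ j → IsInteger (fromℤ (+ D) ℚ.* G j)
  DG-integer j with ℕ.<-≤-connex j (suc k)
  ... | inj₁ j≤k = int j j≤k
  ... | inj₂ k<j = 0ℤ , ≡.trans (≡.cong (fromℤ (+ D) ℚ.*_) (G-high j k<j)) (ℚ.*-zeroʳ (fromℤ (+ D)))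
  g : ℕ → ℤ
  g j = proj₁ (DG-integer j)
  DG≡g : ∀ j → fromℤ (+ D) ℚ.* G j ≡ fromℤ (g j)
  DG≡g j = proj₂ (DG-integer j)
  g₀≡D : g 0 ≡ + D
  g₀≡D = fromℤ-injective (≡.trans (≡.sym (DG≡g 0))
    (≡.trans (≡.cong (fromℤ (+ D) ℚ.*_) G₀≡1) (ℚ.*-identityʳ (fromℤ (+ D)))))
  g-high : ∀ j → k ℕ.< j → g j ≡ 0ℤ
  g-high j k<j = fromℤ-injective (≡.trans (≡.sym (DG≡g j))
    (≡.trans (≡.cong (fromℤ (+ D) ℚ.*_) (G-high j k<j)) (ℚ.*-zeroʳ (fromℤ (+ D)))))
  -- For j > k the truncated `k ∸ j` is not k - j, but there G j = 0.
  nat-split : ∀ j → (ℚ-Seq.nat (k ℕ.∸ j) ℚ.+ ℚ-Seq.nat j) ℚ.* G j ≡ ℚ-Seq.nat k ℚ.* G j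
  nat-split j with ℕ.<-≤-connex k j
  ... | inj₁ k<j = ≡.trans (≡.cong ((ℚ-Seq.nat (k ℕ.∸ j) ℚ.+ ℚ-Seq.nat j) ℚ.*_) (G-high j k<j))
    (≡.trans (ℚ.*-zeroʳ (ℚ-Seq.nat (k ℕ.∸ j) ℚ.+ ℚ-Seq.nat j))
      (≡.sym (≡.trans (≡.cong (ℚ-Seq.nat k ℚ.*_) (G-high j k<j)) (ℚ.*-zeroʳ (ℚ-Seq.nat k)))))
  ... | inj₂ j≤k = ≡.cong (ℚ._* G j) (≡.trans (≡.sym (nat-+ (k ℕ.∸ j) j)) (≡.cong ℚ-Seq.nat (ℕ.m∸n+n≡m j≤k)))
  convDG : ∀ j → j ℕ.≤ L → fromℤ (ℤ-Seq.conv g s j) ≡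
    fromℤ (+ D) ℚ.* (fromℤ n ℚ.* (ℚ-Seq.nat e ℚ.* (ℚ-Seq.nat (k ℕ.∸ j) ℚ.* G j)))
  convDG j j≤L = begin
    fromℤ (ℤ-Seq.conv g s j)                        ≡⟨ fromℤ-conv g s j ⟩
    ℚ-Seq.conv (fromℤ ∘ g) (fromℤ ∘ s) j
      ≡⟨ ℚ-Seq.conv-cong j (λ i _ → ≡.sym (DG≡g i)) (λ i i≤j → ≡.sym (S≡s i (ℕ.≤-trans i≤j j≤L))) ⟩
    ℚ-Seq.conv (λ i → fromℤ (+ D) ℚ.* G i) S j      ≡⟨ ℚ-Seq.conv-scaleˡ (fromℤ (+ D)) G S j ⟩
    fromℤ (+ D) ℚ.* ℚ-Seq.conv G S j                ≡⟨ ≡.cong (fromℤ (+ D) ℚ.*_) (recurrence j) ⟩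
    fromℤ (+ D) ℚ.* (fromℤ n ℚ.* (ℚ-Seq.nat e ℚ.* (ℚ-Seq.nat (k ℕ.∸ j) ℚ.* G j))) ∎
  fromℤ-n′* : ∀ x → fromℤ (n′ ℤ.* x) ≡ fromℤ n ℚ.* ℚ-Seq.nat e ℚ.* fromℤ x
  fromℤ-n′* x = ≡.trans (fromℤ-* n′ x) (≡.cong (ℚ._* fromℤ x)
    (≡.trans (fromℤ-* n (+ e)) (≡.cong (fromℤ n ℚ.*_) (≡.sym (nat≡fromℤ e)))))
  fromℤ-mg : ∀ m j → fromℤ (+ m ℤ.* g j) ≡ ℚ-Seq.nat m ℚ.* (fromℤ (+ D) ℚ.* G j)
  fromℤ-mg m j = ≡.trans (fromℤ-* (+ m) (g j)) (≡.cong₂ ℚ._*_ (≡.sym (nat≡fromℤ m)) (≡.sym (DG≡g j)))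
  eqn : ∀ j → j ℕ.≤ L → ℤ-Seq.conv g s j ℤ.+ n′ ℤ.* (+ j ℤ.* g j) ≡ n′ ℤ.* + k ℤ.* g j
  eqn j j≤L = fromℤ-injective (begin
    fromℤ (ℤ-Seq.conv g s j ℤ.+ n′ ℤ.* (+ j ℤ.* g j))
      ≡⟨ fromℤ-+ (ℤ-Seq.conv g s j) (n′ ℤ.* (+ j ℤ.* g j)) ⟩
    fromℤ (ℤ-Seq.conv g s j) ℚ.+ fromℤ (n′ ℤ.* (+ j ℤ.* g j))
      ≡⟨ ≡.cong₂ ℚ._+_ (convDG j j≤L) (≡.trans (fromℤ-n′* (+ j ℤ.* g j))
           (≡.cong (fromℤ n ℚ.* ℚ-Seq.nat e ℚ.*_) (fromℤ-mg j j))) ⟩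
    δ ℚ.* (ν ℚ.* (ε ℚ.* (κ ℚ.* G j))) ℚ.+ ν ℚ.* ε ℚ.* (ℚ-Seq.nat j ℚ.* (δ ℚ.* G j))
      ≡⟨ solve 6 (λ d n e m j g → d :* (n :* (e :* (m :* g))) :+ n :* e :* (j :* (d :* g))
           := n :* e :* d :* ((m :+ j) :* g)) ≡.refl δ ν ε κ (ℚ-Seq.nat j) (G j) ⟩
    ν ℚ.* ε ℚ.* δ ℚ.* ((κ ℚ.+ ℚ-Seq.nat j) ℚ.* G j)
      ≡⟨ ≡.cong (ν ℚ.* ε ℚ.* δ ℚ.*_) (nat-split j) ⟩
    ν ℚ.* ε ℚ.* δ ℚ.* (ℚ-Seq.nat k ℚ.* G j)
      ≡⟨ solve 5 (λ d n e k g → n :* e :* d :* (k :* g) := n :* e :* (k :* (d :* g)))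
           ≡.refl δ ν ε (ℚ-Seq.nat k) (G j) ⟩
    ν ℚ.* ε ℚ.* (ℚ-Seq.nat k ℚ.* (δ ℚ.* G j))
      ≡⟨ ≡.trans (fromℤ-n′* (+ k ℤ.* g j)) (≡.cong (fromℤ n ℚ.* ℚ-Seq.nat e ℚ.*_) (fromℤ-mg k j)) ⟨
    fromℤ (n′ ℤ.* (+ k ℤ.* g j))
      ≡⟨ ≡.cong fromℤ (ℤ.*-assoc n′ (+ k) (g j)) ⟨
    fromℤ (n′ ℤ.* + k ℤ.* g j) ∎)
    where
    δ = fromℤ (+ D)
    ν = fromℤ n
    ε = ℚ-Seq.nat e
    κ = ℚ-Seq.nat (k ℕ.∸ j)
  divide : ∀ j → + D ∣ g j → IsInteger (G j)
  divide j (divides q eq) = q , (begin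
    G j                                   ≡⟨ ℚ.*-identityˡ (G j) ⟨
    1ℚ ℚ.* G j                            ≡⟨ ≡.cong (ℚ._* G j) uD≡1 ⟨
    u ℚ.* fromℤ (+ D) ℚ.* G j             ≡⟨ ℚ.*-assoc u (fromℤ (+ D)) (G j) ⟩
    u ℚ.* (fromℤ (+ D) ℚ.* G j)
      ≡⟨ ≡.cong (u ℚ.*_) (≡.trans (DG≡g j) (≡.trans (≡.cong fromℤ eq) (fromℤ-* q (+ D)))) ⟩
    u ℚ.* (fromℤ q ℚ.* fromℤ (+ D))
      ≡⟨ solve 3 (λ u q d → u :* (q :* d) := u :* d :* q) ≡.refl u (fromℤ q) (fromℤ (+ D)) ⟩
    u ℚ.* fromℤ (+ D) ℚ.* fromℤ q         ≡⟨ ≡.cong (ℚ._* fromℤ q) uD≡1 ⟩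
    1ℚ ℚ.* fromℤ q                        ≡⟨ ℚ.*-identityˡ (fromℤ q) ⟩
    fromℤ q                               ∎)
    where
    D≢0ℚ : fromℤ (+ D) ≢ 0ℚ
    D≢0ℚ eq = ℕ.≢-nonZero⁻¹ D {{D≢0}} (ℤ.+-injective (fromℤ-injective eq))
    u = proj₁ (*-inverseˡ-≢0 D≢0ℚ)
    uD≡1 : u ℚ.* fromℤ (+ D) ≡ 1ℚ
    uD≡1 = proj₂ (*-inverseˡ-≢0 D≢0ℚ)

-- Reversed minimal polynomials and conjugates.

module Conjugates {c ℓ₁ ℓ₂} (K : FieldExtensionOfℚ c ℓ₁ ℓ₂) where
  open FieldExtensionOfℚ K hiding (zero)
  open Extension K using (module K[X]; ιₚ; IsRoot; IsMinimalPolynomial; IsGaloisOverℚ; IsAlgebraicInteger)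
  open MinimalPolynomials K
  open Horner commutativeRing

  -- The coefficients of Xᵏ p(1/X). For j > k the index `k ∸ j` stays at 0 and would repeat the
  -- constant term, hence the truncation.
  reversed : List ℚ → ℕ → ℕ → ℚ
  reversed p k = ℚ-Seq.trunc (suc k) (λ j → ℚ[X].coeff p (k ℕ.∸ j))

  eval-reversed : ∀ p k x → (∀ m → k ℕ.< m → ℚ[X].coeff p m ≡ 0ℚ) →
    K[X].eval (ιₚ p) x ≈ horner (suc k) (ι ∘ reversed p k) x
  eval-reversed p k x high = trans (eval-horner p k x high)
    (horner-cong (suc k) x (λ j j≤k → ι-cong (≡.sym (ℚ-Seq.trunc-< (suc k) _ j≤k))))

  degree≢0 : ∀ {p x} → ¬ (1# ≈ 0#) → IsRoot p x → ¬ ℚ[X].MonicOfDegree 0 p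
  degree≢0 {p} {x} 1≉0 root (top , high) = 1≉0 (begin
    1#                                     ≈⟨ ι-1 ⟨
    ι 1ℚ                                   ≈⟨ ι-cong top ⟨
    ι (ℚ[X].coeff p 0)                     ≈⟨ +-identityˡ _ ⟨
    0# + ι (ℚ[X].coeff p 0)                ≈⟨ +-congʳ (zeroʳ x) ⟨
    x * 0# + ι (ℚ[X].coeff p 0)            ≈⟨ eval-reversed p 0 x high ⟨
    K[X].eval (ιₚ p) x                     ≈⟨ root ⟩
    0#                                     ∎)
    where open SetoidReasoning setoid

  -- `IsConjugate` lets each y bring its own minimal polynomial p′ of x. The value of p is a
  -- polynomial function on the roots of p′ that vanishes at x, so it vanishes at y.
  conjugate⇒root : ∀ {p p′ x y} → IsGaloisOverℚ (U {A = Carrier}) → ¬ (1# ≈ 0#) →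
    IsRoot p x → IsMinimalPolynomial p′ x → IsRoot p′ y → IsRoot p y
  conjugate⇒root {p} {p′} {x} {y} galois 1≉0 px≈0 record { degree = zero ; monic = monic ; isRoot = isRoot } _ =
    contradiction monic (degree≢0 {p′} 1≉0 isRoot)
  conjugate⇒root {p} {p′} {x} {y} galois 1≉0 px≈0
    record { degree = suc k′ ; monic = top , high ; isRoot = isRoot ; minimal = minimal } p′y≈0 =
    vanishes-at-roots (poly-eval p identity) px≈0 y (trans (sym (eval-reversed p′ (suc k′) y high)) p′y≈0)
    where
    open Roots k′ (reversed p′ (suc k′)) top
    open Irreducible galois (trans (sym (eval-reversed p′ (suc k′) x high)) isRoot) minimal
    -- Written as x · 1 and reduced by `mulX`, since X itself has degree below k only when k ≥ 2.
    identity : PolynomialOnRoots (λ x → x)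
    identity = poly-resp (λ x _ → trans (*-congˡ ι-1) (*-identityʳ x)) (poly-X* (poly-const 1ℚ))

  integral-root : ∀ {p k x} → ℚ[X].MonicOfDegree k p → (∀ j → IsInteger (reversed p k j)) → IsRoot p x →
    IsAlgebraicInteger x
  integral-root {p} {k} {x} (top , high) int root = polyOf (suc k) z ,
    (k , polyOf-monic ℤ.+-*-commutativeRing k z (fromℤ-injective (≡.trans (≡.sym (proj₂ (int 0))) top))) ,
    (begin
      K[X].eval (ιₚ (map fromℤ (polyOf (suc k) z))) x
        ≈⟨ reflexive (≡.cong (λ q → K[X].eval (ιₚ q) x) (map-polyOf fromℤ (suc k) z)) ⟩
      K[X].eval (ιₚ (polyOf (suc k) (fromℤ ∘ z))) x     ≈⟨ eval-polyOf (suc k) (fromℤ ∘ z) x ⟩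
      horner (suc k) (ι ∘ fromℤ ∘ z) x
        ≈⟨ horner-cong (suc k) x (λ j _ → ι-cong (≡.sym (proj₂ (int j)))) ⟩
      horner (suc k) (ι ∘ reversed p k) x               ≈⟨ eval-reversed p k x high ⟨
      K[X].eval (ιₚ p) x                                ≈⟨ root ⟩
      0#                                                ∎)
    where
    open SetoidReasoning setoid
    z : ℕ → ℤ
    z j = proj₁ (int j)

-- Integrality of the minimal polynomial and of its roots.

module Integrality {c ℓ₁ ℓ₂} (K : FieldExtensionOfℚ c ℓ₁ ℓ₂) where
  open FieldExtensionOfℚ K hiding (zero)
  open Extension K hiding (Carrier; _≈_; 0#; ι; _·_; _^_; sum-syntax)
  open Exp semiring using (_^_)
  open Sum semiring using (sum)
  open MinimalPolynomials K
  open PowerTraces K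
  open Conjugates K

  nontrivial : ∀ {x} → ¬ (x ≈ 0#) → ¬ (1# ≈ 0#)
  nontrivial {x} x≉0 1≈0 = x≉0 (trans (sym (*-identityʳ x)) (trans (*-congˡ 1≈0) (zeroʳ x)))

  minimal-polynomial-integral : ∀ {p x r} → IsGaloisOverℚ (U {A = Carrier}) → ¬ (1# ≈ 0#) →
    (mp : IsMinimalPolynomial p x) (α : Fin r → Carrier) → (∀ i → IsRoot p (α i)) →
    ∀ {d} (B : Basis d) (b : Fin r → ℤ) (n : ℤ) → ℤ-Sum.sum b ≡ n → n ≢ 0ℤ →
    (∀ j → 1 ℕ.≤ j → j ℕ.≤ d ℕ.+ d ℕ.* ⌊log₂ (∣ n ∣ ℕ.* d) ⌋ ℕ.+ 1 →
      IsInteger (Tr B (sum (λ i → ι (fromℤ (b i)) * α i ^ j)))) →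
    ∀ j → IsInteger (reversed p (IsMinimalPolynomial.degree mp) j)
  minimal-polynomial-integral {p} galois 1≉0 record { degree = zero ; monic = monic ; isRoot = isRoot } =
    contradiction monic (degree≢0 {p} 1≉0 isRoot)
  minimal-polynomial-integral {p} {x} {r} galois 1≉0
    record { degree = suc k′ ; monic = top , high ; isRoot = isRoot ; minimal = minimal }
    α α-root {d} B b n ∑b≡n n≢0 S-int =
    integral-coefficients n e k L N G S n≢0 e≢0 nek<2^N Nk≤L top
      (λ j k<j → ℚ-Seq.trunc-≥ (suc k) _ k<j) recurrence S-int
    where
    G = reversed p (suc k′)
    open Roots k′ G top
    open Irreducible galois {x} (trans (sym (eval-reversed p k x high)) isRoot) minimal
    root : ∀ {y} → IsRoot p y → Root y
    root {y} py = trans (sym (eval-reversed p k y high)) py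
    -- `inverse-on-roots` finds inverses at x with coefficients valid at every root, so the trace
    -- computation is available over each ℚ(y).
    module At {y} (py : IsRoot p y) = RootTrace.AtRoot K k′ G top (root py)
      (λ q j<k qj≢0 → proj₁ (inverse-on-roots q j<k qj≢0) , proj₂ (inverse-on-roots q j<k qj≢0) y (root py))
    e = d ℕ./ k
    l = ⌊log₂ (∣ n ∣ ℕ.* d) ⌋
    L = d ℕ.+ d ℕ.* l ℕ.+ 1
    N = suc l
    S : ℕ → ℚ
    S j = Tr B (sum (λ i → ι (fromℤ (b i)) * α i ^ j))

    ek≡d : e ℕ.* k ≡ d
    ek≡d = At.degree-divides isRoot B

    d≢0 : d ≢ 0
    -- For d = 0 the spanning sum is empty and would make 1 equal to 0.
    d≢0 ≡.refl = 1≉0 (proj₂ (Basis.spanning B 1#))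

    e≢0 : e ≢ 0
    e≢0 e≡0 = d≢0 (≡.trans (≡.sym ek≡d) (≡.cong (ℕ._* k) e≡0))

    k≤d : k ℕ.≤ d
    k≤d = ≡.subst (k ℕ.≤_) ek≡d (ℕ.m≤n*m k e {{ℕ.≢-nonZero e≢0}})

    nek<2^N : ∣ n ∣ ℕ.* (e ℕ.* k) ℕ.< 2 ℕ.^ N
    nek<2^N = ≡.subst (λ m → ∣ n ∣ ℕ.* m ℕ.< 2 ℕ.^ N) (≡.sym ek≡d) (m<2^[1+⌊log₂m⌋] (∣ n ∣ ℕ.* d))

    -- The origin of the bound on j: each of the N = 1 + l factors p costs t ≤ k ≤ d degrees, and (1
    -- + l) d = d + d l.
    Nk≤L : N ℕ.* k ℕ.≤ L
    Nk≤L = begin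
      N ℕ.* k                ≤⟨ ℕ.*-monoʳ-≤ N k≤d ⟩
      d ℕ.+ l ℕ.* d          ≡⟨ ≡.cong (d ℕ.+_) (ℕ.*-comm l d) ⟩
      d ℕ.+ d ℕ.* l          ≤⟨ ℕ.m≤m+n _ 1 ⟩
      L                      ∎
      where open ℕ.≤-Reasoning

    recurrence : ∀ j → ℚ-Seq.conv G S j ≡ fromℤ n ℚ.* (ℚ-Seq.nat e ℚ.* (ℚ-Seq.nat (k ℕ.∸ j) ℚ.* G j))
    recurrence j = begin
      ℚ-Seq.conv G S j
        ≡⟨ ℚ-Seq.conv-cong j (λ _ _ → ≡.refl) (λ l _ → ≡.trans (sum-hom {r} _)
             (ℚ-Sum.sum-cong-≗ {r} (λ i → ι-hom (fromℤ (b i)) (α i ^ l)))) ⟩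
      ℚ-Seq.conv G (λ l → ℚ-Sum.sum {r} (λ i → fromℤ (b i) ℚ.* Tr B (α i ^ l))) j
        ≡⟨ conv-sum G (fromℤ ∘ b) (λ i l → Tr B (α i ^ l)) j ⟩
      ℚ-Sum.sum {r} (λ i → fromℤ (b i) ℚ.* ℚ-Seq.conv G (λ l → Tr B (α i ^ l)) j)
        ≡⟨ ℚ-Sum.sum-cong-≗ {r} (λ i → ≡.cong (fromℤ (b i) ℚ.*_)
             (At.Tr-power-recurrence (α-root i) B (λ j k<j → ℚ-Seq.trunc-≥ (suc k) _ k<j) j)) ⟩
      ℚ-Sum.sum {r} (λ i → fromℤ (b i) ℚ.* X)   ≡⟨ ℚ-Sum.*-distribʳ-sum {r} X (fromℤ ∘ b) ⟨
      ℚ-Sum.sum (fromℤ ∘ b) ℚ.* X               ≡⟨ ≡.cong (ℚ._* X) (fromℤ-sum b) ⟨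
      fromℤ (ℤ-Sum.sum b) ℚ.* X                 ≡⟨ ≡.cong (λ m → fromℤ m ℚ.* X) ∑b≡n ⟩
      fromℤ n ℚ.* X                             ∎
      where
      open ≡.≡-Reasoning
      open IsLinear (Tr-linear B) using (sum-hom; ι-hom)
      X = ℚ-Seq.nat e ℚ.* (ℚ-Seq.nat (k ℕ.∸ j) ℚ.* G j)

open import Data.Nat.Base using (_+_; _*_; _≤_)

theorem2p10 : ∀ {c ℓ₁ ℓ₂} (K : FieldExtensionOfℚ c ℓ₁ ℓ₂) →
    let open Extension K in
    (r : ℕ) → let k = 2 + r in
    (α : Fin k → Carrier) →
    ¬ (α zero ≈ 0#) →
    IsAlgebraic (α zero) →
    EnumeratesConjugates (α zero) α →
    IsGaloisClosureOfℚ⟨ α zero ⟩ →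
    (d : ℕ) (B : Basis d) →
    (b : Fin k → ℤ) (n : ℤ) →
    ℤ-Sum.sum b ≡ n →
    n ≢ 0ℤ →
    (∀ (j : ℕ) → 1 ≤ j → j ≤ d + d * ⌊log₂ (∣ n ∣ * d) ⌋ + 1 →
    IsInteger (Tr B (∑[ i < k ] (ι (fromℤ (b i)) · (α i ^ j))))) →
    IsAlgebraicInteger (α zero) × (∀ (i : Fin (1 + r)) → IsAlgebraicInteger (α (suc i)))
theorem2p10 K r α α₀≉0 _ conjugates closure d B b n ∑b≡n n≢0 traces = integral zero , integral ∘ suc
  where
  open Extension K
  open EnumeratesConjugates conjugates using (conjugate)
  open IsGaloisClosureOfℚ⟨_⟩ closure using (galois)
  open Conjugates K
  open Integrality K
  -- The minimal polynomial of `α zero` comes from its being listed as a conjugate of itself; it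
  -- serves as the common polynomial of all `α i`.
  p = proj₁ (conjugate zero)
  open IsMinimalPolynomial (proj₁ (proj₂ (conjugate zero))) using (degree; monic; isRoot)
  root : ∀ i → IsRoot p (α i)
  root i with pᵢ , mpᵢ , rootᵢ ← conjugate i =
    conjugate⇒root {p} {pᵢ} galois (nontrivial α₀≉0) isRoot mpᵢ rootᵢ
  integral : ∀ i → IsAlgebraicInteger (α i)
  integral i = integral-root {p} monic (minimal-polynomial-integral galois (nontrivial α₀≉0)
    (proj₁ (proj₂ (conjugate zero))) α root B b n ∑b≡n n≢0 traces) (root i)
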